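{- Let $k,j\ge 1$ and let $\hat 0,\hat 1,b_1,\dots,b_k,c_1,\dots,c_j$ be distinct vertices. Let $Q$ be the acyclic quiver on these vertices with arcs $\hat 0\to b_1\to b_2\to\cdots\to b_k\to\hat 1$, $\hat 0\to c_1\to c_2\to\cdots\to c_j\to\hat 1$, and $\hat 0\to\hat 1$. Put $b_0=c_0=\hat 0$, $b_{k+1}=c_{j+1}=\hat 1$, $\mathbf{b}=(b_1,\dots,b_k)$, $\mathbf{c}=(c_1,\dots,c_j)$, $\mathrm{rev}(\mathbf{b})=(b_k,\dots,b_1)$. Then $$\Psi_{\rm tor}^{[Q]}(\mathbf{x})=\frac{(-1)^k}{\prod_{r=0}^{k}(x_{b_{r+1}}-x_{b_r})\cdot\prod_{s=0}^{j}(x_{c_s}-x_{c_{s+1}})},$$ or equivalently, $$\sum_{\mathbf{a}}\Psi_{\rm tor}^{[(\hat 1,\hat 0,\mathbf{a})]}(\mathbf{x})=(-1)^k\,\Psi_{\rm tor}^{[(\hat 1,\mathrm{rev}(\mathbf{b}),\hat 0,\mathbf{c})]}(\mathbf{x}),$$ where $\mathbf{a}$ ranges over the shuffle set of $\mathbf{b}$ and $\mathbf{c}$.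
   Context: The shuffle set of $\mathbf{b}=(b_1,\dots,b_k)$ and $\mathbf{c}=(c_1,\dots,c_j)$ is the set of all permutations of $(b_1,\dots,b_k,c_1,\dots,c_j)$ in which the $b_i$ appear in the same relative order as in $\mathbf{b}$ and the $c_i$ in the same relative order as in $\mathbf{c}$. All quivers are finite directed graphs that are simple (no loops, no parallel or anti-parallel arcs) and acyclic, on a finite vertex set $V$ with $|V|=n$. A source is a vertex all of whose incident arcs point away from it; a sink is a vertex all of whose incident arcs point into it (an isolated vertex is both). A flip at a source or sink $k$ reverses all arcs incident to $k$. Two acyclic quivers are equivalent if they are related by a finite sequence of flips; the equivalence class $[Q]$ of $Q$ is called a toric poset; all its members have the same underlying undirected graph. A toric total order $[w]=[(w_1,\dots,w_n)]$ is the equivalence class of a permutation $(w_1,\dots,w_n)$ of $V$ under cyclic rotation $(w_1,\dots,w_n)\mapsto(w_2,\dots,w_n,w_1)$. For a graph $G$ on $V$, let $\mathcal{A}_{\rm tor}(G)$ be the image in $\mathbb{R}^V/\mathbb{Z}^V$ of $\bigcup_{\{i,j\}\in G}\{x_i=x_j\}\subset\mathbb{R}^V$. A point of $\mathbb{R}^V/\mathbb{Z}^V-\mathcal{A}_{\rm tor}(G)$ determines an acyclic orientation of $G$: $i\to j$ if $x_i \bmod 1< x_j \bmod 1$ (values in $[0,1)$), and $j\to i$ otherwise. For a toric poset $[Q]$ with underlying graph $G$, its toric chamber $c_{[Q]}$ is the set of points whose orientation lies in $[Q]$ (these sets are exactly the connected components of $\mathbb{R}^V/\mathbb{Z}^V-\mathcal{A}_{\rm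 tor}(G)$). For a toric total order $[w]$, $c_{[w]}$ is the set of points with pairwise distinct coordinates such that listing the indices in increasing order of $x_i\bmod 1$ gives a member of $[w]$. $[w]$ is a toric total extension of $[Q]$ if $c_{[w]}\subseteq c_{[Q]}$; the set of these is $\mathcal{L}_{\rm tor}([Q])$. Define $\Psi_{\rm tor}^{[Q]}(\mathbf{x})=\sum_{[w]\in\mathcal{L}_{\rm tor}([Q])}\Psi_{\rm tor}^{[w]}(\mathbf{x})$, where $\Psi_{\rm tor}^{[w]}(\mathbf{x})=\dfrac{1}{(x_{w_1}-x_{w_2})(x_{w_2}-x_{w_3})\cdots(x_{w_{n-1}}-x_{w_n})(x_{w_n}-x_{w_1})}$ and $\mathbf{x}=(x_v)_{v\in V}$ are indeterminates. -}

module Defs where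

open import Algebra.Bundles using (CommutativeRing)
open import Algebra.Core using (Op₁; Op₂)
import Algebra.Properties.Ring as RingProperties
import Algebra.Properties.Semiring.Exp as Exp
import Algebra.Solver.Ring.NaturalCoefficients.Default as SemiringSolver
open import Data.Bool using (Bool; T)
open import Data.Fin using (Fin; zero; suc; toℕ)
import Data.Fin.Properties as Fin
open import Data.List using (List; []; _∷_; [_]; _++_; foldr; tabulate)
open import Data.List.Membership.Propositional using (_∈_)
import Data.List.Membership.DecPropositional as DecMembership
open import Data.List.Relation.Unary.All using (All; []; _∷_; all?)
import Data.List.Relation.Unary.All as All using (lookup)
import Data.List.Relation.Unary.All.Properties as All using (++⁺)
open import Data.List.Relation.Unary.AllPairs using (AllPairs)
open import Data.List.Relation.Unary.Any using (Any)
open import Data.List.Relation.Unary.Unique.Propositional using (Unique)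
open import Data.List.Relation.Binary.Permutation.Propositional using (_↭_)
open import Data.List.Relation.Binary.Sublist.Propositional using (_⊆_)
open import Data.Nat as ℕ using (ℕ; zero; suc)
import Data.Nat.Properties as ℕ
open import Data.Product using (∃; ∃₂; ∃-syntax; _×_; _,_; uncurry)
import Data.Product.Properties as Product
open import Data.Rational as ℚ using (ℚ; 0ℚ; 1ℚ; _/_)
import Data.Rational.Properties as ℚ
open import Data.Sum using (_⊎_; inj₁; inj₂)
open import Function using (_⇔_; mk⇔; _∘_)
open import Level using (Level; _⊔_; 0ℓ)
open import Relation.Binary.Core using (Rel)
open import Relation.Binary.Definitions using (DecidableEquality; tri<; tri≈; tri>)
open import Relation.Binary.Construct.Closure.ReflexiveTransitive using (Star)
open import Relation.Binary.Construct.Closure.Transitive using (TransClosure; _∷_) renaming ([_] to [_]⁺)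
open import Relation.Binary.PropositionalEquality as ≡ using (_≡_; _≢_)
open import Relation.Nullary using (¬_; yes; no; ¬?; contradiction)
open import Relation.Nullary.Decidable using (⌊_⌋; toWitness)

private variable
  a p ℓ : Level
  A : Set a

-- ℝ: two-sided Dedekind cuts (lower set L, upper set U) of rationals.

record ℝ : Set₁ where
  field
    L U         : ℚ → Set
    L-inhabited : ∃ L
    U-inhabited : ∃ U
    L-rounded   : ∀ q → L q ⇔ (∃[ r ] (q ℚ.< r × L r))
    U-rounded   : ∀ q → U q ⇔ (∃[ r ] (r ℚ.< q × U r))
    disjoint    : ∀ q → ¬ (L q × U q)
    located     : ∀ q r → q ℚ.< r → L q ⊎ U r

open ℝ

infix 4 _≃ᴿ_ _<ᴿ_ _≤ᴿ_ _∼ℤ_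

_≃ᴿ_ : ℝ → ℝ → Set
x ≃ᴿ y = ∀ q → (L x q ⇔ L y q) × (U x q ⇔ U y q)

_<ᴿ_ : ℝ → ℝ → Set
x <ᴿ y = ∃[ q ] (U x q × L y q)

_≤ᴿ_ : ℝ → ℝ → Set
x ≤ᴿ y = ¬ (y <ᴿ x)

-- Congruence modulo ℤ: y is the translate x + m for some integer m.

_∼ℤ_ : ℝ → ℝ → Set
x ∼ℤ y = ∃[ m ] ∀ q → (L x q ⇔ L y (q ℚ.+ m / 1)) × (U x q ⇔ U y (q ℚ.+ m / 1))

fromℚ : ℚ → ℝ
fromℚ x = record
  { L           = ℚ._< x
  ; U           = x ℚ.<_
  ; L-inhabited = x ℚ.- 1ℚ , ≡.subst (x ℚ.- 1ℚ ℚ.<_) (ℚ.+-identityʳ x)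
                    (ℚ.+-monoʳ-< x (ℚ.negative⁻¹ (ℚ.- 1ℚ)))
  ; U-inhabited = x ℚ.+ 1ℚ , ≡.subst (ℚ._< x ℚ.+ 1ℚ) (ℚ.+-identityʳ x)
                    (ℚ.+-monoʳ-< x (ℚ.positive⁻¹ 1ℚ))
  ; L-rounded   = λ q → mk⇔ ℚ.<-dense (λ (r , q<r , r<x) → ℚ.<-trans q<r r<x)
  ; U-rounded   = λ q → mk⇔ (λ x<q → let r , x<r , r<q = ℚ.<-dense x<q in r , r<q , x<r)
                            (λ (r , r<q , x<r) → ℚ.<-trans x<r r<q)
  ; disjoint    = λ q (q<x , x<q) → ℚ.<-asym q<x x<q
  ; located     = located-ℚ
  }
  where
  located-ℚ : ∀ q r → q ℚ.< r → q ℚ.< x ⊎ x ℚ.< r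
  located-ℚ q r q<r with ℚ.<-cmp q x
  ... | tri< q<x _ _    = inj₁ q<x
  ... | tri≈ _ ≡.refl _ = inj₂ q<r
  ... | tri> _ _ x<q    = inj₂ (ℚ.<-trans x<q q<r)

steps : List A → List (A × A)
steps []           = []
steps (x ∷ [])     = []
steps (x ∷ y ∷ xs) = (x , y) ∷ steps (y ∷ xs)

cyclicSteps : List A → List (A × A)
cyclicSteps []       = []
cyclicSteps (x ∷ xs) = steps (x ∷ xs ++ [ x ])

rotate : List A → List A
rotate []       = []
rotate (x ∷ xs) = xs ++ [ x ]

-- Two words name the same toric total order. (Rotation has finite order on
-- each word, so iterating it forwards already gives a symmetric relation.)

_≈rot_ : {A : Set} → Rel (List A) 0ℓ
_≈rot_ = Star (λ w w′ → w′ ≡ rotate w)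

IsPermutation : {V : Set} → List V → Set
IsPermutation {V} w = Unique w × (∀ (v : V) → v ∈ w)

IsShuffle : {A : Set} → List A → List A → List A → Set
IsShuffle bs cs as = (as ↭ bs ++ cs) × (bs ⊆ as) × (cs ⊆ as)

-- Acyclicity includes the absence of loops and of anti-parallel arcs; parallel
-- arcs are excluded by recording only whether an arc is present.

record Quiver (V : Set) : Set where
  field
    arc : V → V → Bool

  _⟶_ : V → V → Set
  u ⟶ v = T (arc u v)

  field
    acyclic : ∀ v → ¬ TransClosure _⟶_ v v

  Edge : V → V → Set
  Edge u v = u ⟶ v ⊎ v ⟶ u

  IsSource IsSink : V → Set
  IsSource v = ∀ u → ¬ (u ⟶ v)
  IsSink   v = ∀ u → ¬ (v ⟶ u)

open Quiver using (arc; Edge; IsSource; IsSink)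

module _ {V : Set} where

  record Flip (Q Q′ : Quiver V) : Set where
    field
      vertex         : V
      source-or-sink : IsSource Q vertex ⊎ IsSink Q vertex
      reversed       : ∀ u v → u ≡ vertex ⊎ v ≡ vertex → arc Q′ u v ≡ arc Q v u
      unchanged      : ∀ u v → u ≢ vertex → v ≢ vertex → arc Q′ u v ≡ arc Q u v

  -- Flips are invertible, so reachability by flips is mutual.

  _≈flip_ : Rel (Quiver V) 0ℓ
  _≈flip_ = Star Flip

  -- A family x : V → ℝ stands for its class in ℝ^V / ℤ^V; the subsets of
  -- ℝ^V / ℤ^V below are predicates invariant under integer translation.
  -- y ≡ x mod 1 says that y lists the representatives in [0,1).

  _≡_mod1 : (V → ℝ) → (V → ℝ) → Set
  y ≡ x mod1 = ∀ v → (fromℚ 0ℚ ≤ᴿ y v) × (y v <ᴿ fromℚ 1ℚ) × (x v ∼ℤ y v)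

  -- The toric arrangement of the underlying graph of Q: the image of the
  -- union of the hyperplanes x_i = x_j.

  Arrangement : Quiver V → (V → ℝ) → Set₁
  Arrangement Q x =
    ∃₂ λ u v → Edge Q u v × ∃ λ (x′ : V → ℝ) → (∀ i → x i ∼ℤ x′ i) × (x′ u ≃ᴿ x′ v)

  Chamber : Quiver V → (V → ℝ) → Set₁
  Chamber Q x =
    ¬ Arrangement Q x ×
    ∃ λ (y : V → ℝ) → (y ≡ x mod1) × ∃ λ (Q′ : Quiver V) → (Q ≈flip Q′) ×
      (∀ u v → T (arc Q′ u v) ⇔ (Edge Q u v × y u <ᴿ y v))

  OrderChamber : List V → (V → ℝ) → Set₁
  OrderChamber w x =
    ∃ λ (y : V → ℝ) → (y ≡ x mod1) × ∃ λ (w′ : List V) → (w ≈rot w′) ×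
      AllPairs (λ u v → y u <ᴿ y v) w′

  IsToricExtension : Quiver V → List V → Set₁
  IsToricExtension Q w = IsPermutation w × (∀ x → OrderChamber w x → Chamber Q x)

-- The total ring of fractions: denominators are the non-zero-divisors.

module Fractions {c ℓ} (R : CommutativeRing c ℓ) where
  open CommutativeRing R
  open RingProperties ring
    using (-‿distribˡ-*; x∙y⁻¹≈ε⇒x≈y; x≈y⇒x∙y⁻¹≈ε)
  open SemiringSolver commutativeSemiring using (solve; _:=_; _:+_; _:*_; con)
  open import Relation.Binary.Reasoning.Setoid setoid

  Regular : Carrier → Set (c ⊔ ℓ)
  Regular q = ∀ p → p * q ≈ 0# → p ≈ 0#

  1-regular : Regular 1#
  1-regular p p1≈0 = trans (sym (*-identityʳ p)) p1≈0

  *-regular : ∀ {q r} → Regular q → Regular r → Regular (q * r)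
  *-regular {q} {r} reg-q reg-r p pqr≈0 =
    reg-q p (reg-r (p * q) (trans (*-assoc p q r) pqr≈0))

  cancel : ∀ {q} → Regular q → ∀ x y → x * q ≈ y * q → x ≈ y
  cancel {q} reg x y xq≈yq = x∙y⁻¹≈ε⇒x≈y x y (reg (x - y) (begin
    (x - y) * q        ≈⟨ distribʳ q x (- y) ⟩
    x * q + (- y) * q  ≈⟨ +-congˡ (sym (-‿distribˡ-* y q)) ⟩
    x * q - y * q      ≈⟨ x≈y⇒x∙y⁻¹≈ε xq≈yq ⟩
    0#                 ∎))

  record Fraction : Set (c ⊔ ℓ) where
    constructor frac
    field
      num den : Carrier
      regular : Regular den
  open Fraction

  infix  4 _≃_
  infixl 6 _⊕_
  infixl 7 _⊗_
  infix  8 ⊖_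

  record _≃_ (x y : Fraction) : Set ℓ where
    constructor eq
    field cross : num x * den y ≈ num y * den x
  open _≃_

  _⊕_ _⊗_ : Op₂ Fraction
  frac a b r ⊕ frac c d s = frac (a * d + c * b) (b * d) (*-regular r s)
  frac a b r ⊗ frac c d s = frac (a * c) (b * d) (*-regular r s)

  ⊖_ : Op₁ Fraction
  ⊖ frac a b r = frac (- a) b r

  0F 1F : Fraction
  0F = frac 0# 1# 1-regular
  1F = frac 1# 1# 1-regular

  private
    ≃-trans : ∀ {x y z} → x ≃ y → y ≃ z → x ≃ z
    ≃-trans {frac a b _} {frac c d s} {frac e f _} (eq p) (eq q) =
      eq (cancel s (a * f) (e * b) (begin
        a * f * d  ≈⟨ solve 3 (λ a f d → a :* f :* d := a :* d :* f) refl a f d ⟩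
        a * d * f  ≈⟨ *-congʳ p ⟩
        c * b * f  ≈⟨ solve 3 (λ c b f → c :* b :* f := c :* f :* b) refl c b f ⟩
        c * f * b  ≈⟨ *-congʳ q ⟩
        e * d * b  ≈⟨ solve 3 (λ e d b → e :* d :* b := e :* b :* d) refl e d b ⟩
        e * b * d  ∎))

    ⊕-cong : ∀ {x y u v} → x ≃ y → u ≃ v → x ⊕ u ≃ y ⊕ v
    ⊕-cong {frac a b _} {frac c d _} {frac e f _} {frac g h _} (eq p) (eq q) = eq (begin
      (a * f + e * b) * (d * h)              ≈⟨ solve 6 (λ a b d e f h →
          (a :* f :+ e :* b) :* (d :* h) := (a :* d) :* (f :* h) :+ (e :* h) :* (b :* d))
          refl a b d e f h ⟩
      (a * d) * (f * h) + (e * h) * (b * d)  ≈⟨ +-cong (*-congʳ p) (*-congʳ q) ⟩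
      (c * b) * (f * h) + (g * f) * (b * d)  ≈⟨ solve 6 (λ b c d f g h →
          (c :* b) :* (f :* h) :+ (g :* f) :* (b :* d) := (c :* h :+ g :* d) :* (b :* f))
          refl b c d f g h ⟩
      (c * h + g * d) * (b * f)              ∎)

    ⊗-cong : ∀ {x y u v} → x ≃ y → u ≃ v → x ⊗ u ≃ y ⊗ v
    ⊗-cong {frac a b _} {frac c d _} {frac e f _} {frac g h _} (eq p) (eq q) = eq (begin
      (a * e) * (d * h)  ≈⟨ solve 4 (λ a e d h →
          (a :* e) :* (d :* h) := (a :* d) :* (e :* h)) refl a e d h ⟩
      (a * d) * (e * h)  ≈⟨ *-cong p q ⟩
      (c * b) * (g * f)  ≈⟨ solve 4 (λ c b g f →
          (c :* b) :* (g :* f) := (c :* g) :* (b :* f)) refl c b g f ⟩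
      (c * g) * (b * f)  ∎)

    ⊖-cong : ∀ {x y} → x ≃ y → ⊖ x ≃ ⊖ y
    ⊖-cong {frac a b _} {frac c d _} (eq p) = eq (begin
      (- a) * d  ≈⟨ -‿distribˡ-* a d ⟨
      - (a * d)  ≈⟨ -‿cong p ⟩
      - (c * b)  ≈⟨ -‿distribˡ-* c b ⟩
      (- c) * b  ∎)

    ⊕-comm : ∀ x y → x ⊕ y ≃ y ⊕ x
    ⊕-comm (frac a b _) (frac c d _) = eq (solve 4 (λ a b c d →
      (a :* d :+ c :* b) :* (d :* b) := (c :* b :+ a :* d) :* (b :* d)) refl a b c d)

    ⊕-assoc : ∀ x y z → (x ⊕ y) ⊕ z ≃ x ⊕ (y ⊕ z)
    ⊕-assoc (frac a b _) (frac c d _) (frac e f _) = eq (solve 6 (λ a b c d e f →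
      ((a :* d :+ c :* b) :* f :+ e :* (b :* d)) :* (b :* (d :* f)) :=
      (a :* (d :* f) :+ (c :* f :+ e :* d) :* b) :* ((b :* d) :* f)) refl a b c d e f)

    ⊕-identityˡ : ∀ x → 0F ⊕ x ≃ x
    ⊕-identityˡ (frac a b _) = eq (solve 2 (λ a b →
      (con 0 :* b :+ a :* con 1) :* b := a :* (con 1 :* b)) refl a b)

    ⊕-inverseˡ : ∀ x → ⊖ x ⊕ x ≃ 0F
    ⊕-inverseˡ (frac a b _) = eq (begin
      (- a * b + a * b) * 1#   ≈⟨ *-identityʳ _ ⟩
      - a * b + a * b          ≈⟨ distribʳ b (- a) a ⟨
      (- a + a) * b            ≈⟨ *-congʳ (-‿inverseˡ a) ⟩
      0# * b                   ≈⟨ zeroˡ b ⟩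
      0#                       ≈⟨ zeroˡ (b * b) ⟨
      0# * (b * b)             ∎)

    ⊗-comm : ∀ x y → x ⊗ y ≃ y ⊗ x
    ⊗-comm (frac a b _) (frac c d _) = eq (solve 4 (λ a b c d →
      (a :* c) :* (d :* b) := (c :* a) :* (b :* d)) refl a b c d)

    ⊗-assoc : ∀ x y z → (x ⊗ y) ⊗ z ≃ x ⊗ (y ⊗ z)
    ⊗-assoc (frac a b _) (frac c d _) (frac e f _) = eq (solve 6 (λ a b c d e f →
      ((a :* c) :* e) :* (b :* (d :* f)) := (a :* (c :* e)) :* ((b :* d) :* f))
      refl a b c d e f)

    ⊗-identityˡ : ∀ x → 1F ⊗ x ≃ x
    ⊗-identityˡ (frac a b _) = eq (solve 2 (λ a b →
      (con 1 :* a) :* b := a :* (con 1 :* b)) refl a b)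

    ⊗-distribˡ-⊕ : ∀ x y z → x ⊗ (y ⊕ z) ≃ x ⊗ y ⊕ x ⊗ z
    ⊗-distribˡ-⊕ (frac a b _) (frac c d _) (frac e f _) = eq (solve 6 (λ a b c d e f →
      (a :* (c :* f :+ e :* d)) :* ((b :* d) :* (b :* f)) :=
      ((a :* c) :* (b :* f) :+ (a :* e) :* (b :* d)) :* (b :* (d :* f))) refl a b c d e f)

    ⊗-distribʳ-⊕ : ∀ x y z → (y ⊕ z) ⊗ x ≃ y ⊗ x ⊕ z ⊗ x
    ⊗-distribʳ-⊕ x y z = ≃-trans (⊗-comm (y ⊕ z) x)
      (≃-trans (⊗-distribˡ-⊕ x y z) (⊕-cong (⊗-comm x y) (⊗-comm x z)))

  fractionRing : CommutativeRing (c ⊔ ℓ) ℓ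
  fractionRing = record
    { Carrier = Fraction ; _≈_ = _≃_ ; _+_ = _⊕_ ; _*_ = _⊗_ ; -_ = ⊖_ ; 0# = 0F ; 1# = 1F
    ; isCommutativeRing = record
      { isRing = record
        { +-isAbelianGroup = record
          { isGroup = record
            { isMonoid = record
              { isSemigroup = record
                { isMagma = record
                  { isEquivalence = record
                    { refl  = eq refl
                    ; sym   = λ (eq p) → eq (sym p)
                    ; trans = ≃-trans
                    }
                  ; ∙-cong = ⊕-cong
                  }
                ; assoc = ⊕-assoc
                }
              ; identity = ⊕-identityˡ , λ x → ≃-trans (⊕-comm x 0F) (⊕-identityˡ x)
              }
            ; inverse = ⊕-inverseˡ , λ x → ≃-trans (⊕-comm x (⊖ x)) (⊕-inverseˡ x)
            ; ⁻¹-cong = ⊖-cong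
            }
          ; comm = ⊕-comm
          }
        ; *-cong     = ⊗-cong
        ; *-assoc    = ⊗-assoc
        ; *-identity = ⊗-identityˡ , λ x → ≃-trans (⊗-comm x 1F) (⊗-identityˡ x)
        ; distrib    = ⊗-distribˡ-⊕ , ⊗-distribʳ-⊕
        }
      ; *-comm = ⊗-comm
      }
    }

-- ℤ[V], as the free commutative ring on the indeterminates X v.

module Polynomials (V : Set) where

  infix  4 _≈_
  infixl 6 _+_
  infixl 7 _*_
  infix  8 -_

  data Poly : Set where
    X       : V → Poly
    0# 1#   : Poly
    _+_ _*_ : Poly → Poly → Poly
    -_      : Poly → Poly

  data _≈_ : Poly → Poly → Set where
    refl       : ∀ {x} → x ≈ x
    sym        : ∀ {x y} → x ≈ y → y ≈ x
    trans      : ∀ {x y z} → x ≈ y → y ≈ z → x ≈ z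
    +-cong     : ∀ {x y u v} → x ≈ y → u ≈ v → x + u ≈ y + v
    *-cong     : ∀ {x y u v} → x ≈ y → u ≈ v → x * u ≈ y * v
    -‿cong     : ∀ {x y} → x ≈ y → - x ≈ - y
    +-assoc    : ∀ x y z → (x + y) + z ≈ x + (y + z)
    +-comm     : ∀ x y → x + y ≈ y + x
    +-identity : ∀ x → 0# + x ≈ x
    -‿inverse  : ∀ x → - x + x ≈ 0#
    *-assoc    : ∀ x y z → (x * y) * z ≈ x * (y * z)
    *-comm     : ∀ x y → x * y ≈ y * x
    *-identity : ∀ x → 1# * x ≈ x
    distrib    : ∀ x y z → x * (y + z) ≈ x * y + x * z

  polyRing : CommutativeRing 0ℓ 0ℓ
  polyRing = record
    { Carrier = Poly ; _≈_ = _≈_ ; _+_ = _+_ ; _*_ = _*_ ; -_ = -_ ; 0# = 0# ; 1# = 1#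
    ; isCommutativeRing = record
      { isRing = record
        { +-isAbelianGroup = record
          { isGroup = record
            { isMonoid = record
              { isSemigroup = record
                { isMagma = record
                  { isEquivalence = record { refl = refl ; sym = sym ; trans = trans }
                  ; ∙-cong = +-cong
                  }
                ; assoc = +-assoc
                }
              ; identity = +-identity , λ x → trans (+-comm x 0#) (+-identity x)
              }
            ; inverse = -‿inverse , λ x → trans (+-comm x (- x)) (-‿inverse x)
            ; ⁻¹-cong = -‿cong
            }
          ; comm = +-comm
          }
        ; *-cong     = *-cong
        ; *-assoc    = *-assoc
        ; *-identity = *-identity , λ x → trans (*-comm x 1#) (*-identity x)
        ; distrib    = distrib , λ x y z → trans (*-comm (y + z) x)
            (trans (distrib x y z) (+-cong (*-comm x y) (*-comm x z)))
        }
      ; *-comm = *-comm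
      }
    }

-- X u - X v is a non-zero-divisor when u ≢ v. With σ the substitution
-- X u := X v, every p has a divided difference D p satisfying
-- p ≈ σ p + (X u - X v) * D p, and D ((X u - X v) * p) ≈ p.

module Difference {V : Set} (_≟_ : DecidableEquality V) (u v : V) where
  open Polynomials V
  open SemiringSolver (CommutativeRing.commutativeSemiring polyRing)
    using (solve; _:=_; _:+_; _:*_; con)
  open CommutativeRing polyRing using (setoid; zeroˡ; zeroʳ; *-congʳ; *-congˡ; +-congˡ; +-congʳ)
  open RingProperties (CommutativeRing.ring polyRing)
    using (-0#≈0#; -‿distribʳ-*; -‿+-comm)
  open Fractions polyRing using (Regular)
  open import Relation.Binary.Reasoning.Setoid setoid

  private
    d : Poly
    d = X u + - X v

    σ : Poly → Poly
    σ (X w) with w ≟ u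
    ... | yes _ = X v
    ... | no  _ = X w
    σ 0#      = 0#
    σ 1#      = 1#
    σ (p + q) = σ p + σ q
    σ (p * q) = σ p * σ q
    σ (- p)   = - σ p

    D : Poly → Poly
    D (X w) with w ≟ u
    ... | yes _ = 1#
    ... | no  _ = 0#
    D 0#      = 0#
    D 1#      = 0#
    D (p + q) = D p + D q
    D (p * q) = D p * q + σ p * D q
    D (- p)   = - D p

    σ-cong : ∀ {p q} → p ≈ q → σ p ≈ σ q
    σ-cong refl             = refl
    σ-cong (sym e)          = sym (σ-cong e)
    σ-cong (trans e f)      = trans (σ-cong e) (σ-cong f)
    σ-cong (+-cong e f)     = +-cong (σ-cong e) (σ-cong f)
    σ-cong (*-cong e f)     = *-cong (σ-cong e) (σ-cong f)
    σ-cong (-‿cong e)       = -‿cong (σ-cong e)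
    σ-cong (+-assoc x y z)  = +-assoc _ _ _
    σ-cong (+-comm x y)     = +-comm _ _
    σ-cong (+-identity x)   = +-identity _
    σ-cong (-‿inverse x)    = -‿inverse _
    σ-cong (*-assoc x y z)  = *-assoc _ _ _
    σ-cong (*-comm x y)     = *-comm _ _
    σ-cong (*-identity x)   = *-identity _
    σ-cong (distrib x y z)  = distrib _ _ _

    expand : ∀ p → p ≈ σ p + d * D p
    expand (X w) with w ≟ u
    ... | yes ≡.refl = begin
      X u                          ≈⟨ +-identity (X u) ⟨
      0# + X u                     ≈⟨ +-congʳ (-‿inverse (X v)) ⟨
      (- X v + X v) + X u          ≈⟨ solve 3 (λ m n o → (m :+ n) :+ o := n :+ (o :+ m) :* con 1)
                                        refl (- X v) (X v) (X u) ⟩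
      X v + (X u + - X v) * 1#     ∎
    ... | no  _      = solve 2 (λ x d → x := x :+ d :* con 0) refl (X w) d
    expand 0#      = solve 1 (λ d → con 0 := con 0 :+ d :* con 0) refl d
    expand 1#      = solve 1 (λ d → con 1 := con 1 :+ d :* con 0) refl d
    expand (p + q) = trans (+-cong (expand p) (expand q))
      (solve 5 (λ s t d a b → (s :+ d :* a) :+ (t :+ d :* b) := (s :+ t) :+ d :* (a :+ b))
        refl (σ p) (σ q) d (D p) (D q))
    expand (p * q) = begin
      p * q                                     ≈⟨ *-congʳ (expand p) ⟩
      (σ p + d * D p) * q                       ≈⟨ solve 4 (λ s d a q →
          (s :+ d :* a) :* q := s :* q :+ d :* (a :* q)) refl (σ p) d (D p) q ⟩
      σ p * q + d * (D p * q)                   ≈⟨ +-congʳ (*-congˡ (expand q)) ⟩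
      σ p * (σ q + d * D q) + d * (D p * q)     ≈⟨ solve 6 (λ s t d a b q →
          s :* (t :+ d :* b) :+ d :* (a :* q) := s :* t :+ d :* (a :* q :+ s :* b))
          refl (σ p) (σ q) d (D p) (D q) q ⟩
      σ p * σ q + d * (D p * q + σ p * D q)     ∎
    expand (- p)   = begin
      - p                     ≈⟨ -‿cong (expand p) ⟩
      - (σ p + d * D p)       ≈⟨ -‿+-comm (σ p) (d * D p) ⟨
      - σ p + - (d * D p)     ≈⟨ +-congˡ (-‿distribʳ-* d (D p)) ⟩
      - σ p + d * (- D p)     ∎

    D-cong : ∀ {p q} → p ≈ q → D p ≈ D q
    D-cong refl             = refl
    D-cong (sym e)          = sym (D-cong e)
    D-cong (trans e f)      = trans (D-cong e) (D-cong f)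
    D-cong (+-cong e f)     = +-cong (D-cong e) (D-cong f)
    D-cong (*-cong e f)     =
      +-cong (*-cong (D-cong e) f) (*-cong (σ-cong e) (D-cong f))
    D-cong (-‿cong e)       = -‿cong (D-cong e)
    D-cong (+-assoc x y z)  = +-assoc _ _ _
    D-cong (+-comm x y)     = +-comm _ _
    D-cong (+-identity x)   = +-identity _
    D-cong (-‿inverse x)    = -‿inverse _
    D-cong (*-assoc x y z)  = solve 7 (λ a b c s t y z →
      (a :* y :+ s :* b) :* z :+ (s :* t) :* c := a :* (y :* z) :+ s :* (b :* z :+ t :* c))
      refl (D x) (D y) (D z) (σ x) (σ y) y z
    D-cong (*-comm x y)     = begin
      D x * y + σ x * D y                      ≈⟨ +-congʳ (*-congˡ (expand y)) ⟩
      D x * (σ y + d * D y) + σ x * D y        ≈⟨ solve 5 (λ a b s t d →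
          a :* (t :+ d :* b) :+ s :* b := b :* (s :+ d :* a) :+ t :* a)
          refl (D x) (D y) (σ x) (σ y) d ⟩
      D y * (σ x + d * D x) + σ y * D x        ≈⟨ +-congʳ (*-congˡ (expand x)) ⟨
      D y * x + σ y * D x                      ∎
    D-cong (*-identity x)   = solve 2 (λ x a → con 0 :* x :+ con 1 :* a := a) refl x (D x)
    D-cong (distrib x y z)  = solve 6 (λ a b c s y z →
      a :* (y :+ z) :+ s :* (b :+ c) := (a :* y :+ s :* b) :+ (a :* z :+ s :* c))
      refl (D x) (D y) (D z) (σ x) y z

    σ-u : σ (X u) ≈ X v
    σ-u with u ≟ u
    ... | yes _  = refl
    ... | no u≢u = contradiction ≡.refl u≢u

    D-u : D (X u) ≈ 1#
    D-u with u ≟ u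
    ... | yes _  = refl
    ... | no u≢u = contradiction ≡.refl u≢u

    module _ (u≢v : u ≢ v) where

      σ-v : σ (X v) ≈ X v
      σ-v with v ≟ u
      ... | yes v≡u = contradiction (≡.sym v≡u) u≢v
      ... | no  _   = refl

      D-v : D (X v) ≈ 0#
      D-v with v ≟ u
      ... | yes v≡u = contradiction (≡.sym v≡u) u≢v
      ... | no  _   = refl

      σ-d : σ d ≈ 0#
      σ-d = trans (+-cong σ-u (-‿cong σ-v)) (trans (+-comm _ _) (-‿inverse (X v)))

      D-d : D d ≈ 1#
      D-d = trans (+-cong D-u (trans (-‿cong D-v) -0#≈0#)) (trans (+-comm _ _) (+-identity 1#))

  regular : u ≢ v → Regular (X u + - X v)
  regular u≢v p pd≈0 = begin
    p                      ≈⟨ solve 2 (λ p a → p := con 1 :* p :+ con 0 :* a) refl p (D p) ⟩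
    1# * p + 0# * D p      ≈⟨ +-cong (*-congʳ (D-d u≢v)) (*-congʳ (σ-d u≢v)) ⟨
    D (d * p)              ≈⟨ D-cong (trans (*-comm d p) pd≈0) ⟩
    0#                     ∎

-- The field ℚ(V) of rational functions in the indeterminates X v: since ℤ[V]
-- is an integral domain, its non-zero-divisors are its nonzero elements and
-- its total ring of fractions is its field of fractions.

module RationalFunctions {V : Set} (_≟_ : DecidableEquality V) where
  open Polynomials V using (Poly; X; polyRing)
  private
    module ℤ[V] = CommutativeRing polyRing
    module F = Fractions polyRing

  ℚ⟨V⟩ : CommutativeRing 0ℓ 0ℓ
  ℚ⟨V⟩ = F.fractionRing

  open CommutativeRing ℚ⟨V⟩ using (Carrier; _+_; _*_; -_; 0#; 1#)
  open Exp (CommutativeRing.semiring ℚ⟨V⟩) using (_^_)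

  ∑ : {A : Set} → List A → (A → Carrier) → Carrier
  ∑ as f = foldr (λ a s → f a + s) 0# as

  ∏-diff : List (V × V) → Poly
  ∏-diff = foldr (λ (u , v) q → (X u ℤ[V].- X v) ℤ[V].* q) ℤ[V].1#

  ∏-diff-regular : ∀ {ps} → All (uncurry _≢_) ps → F.Regular (∏-diff ps)
  ∏-diff-regular []          = F.1-regular
  ∏-diff-regular {(u , v) ∷ _} (u≢v ∷ ps) =
    F.*-regular (Difference.regular _≟_ u v u≢v) (∏-diff-regular ps)

  -- 1 / ∏ (x_u - x_v) over the pairs (u , v) in the list. If some factor is
  -- zero the value is 0 by convention.

  1/∏-diff : List (V × V) → Carrier
  1/∏-diff ps with all? (λ (u , v) → ¬? (u ≟ v)) ps
  ... | yes distinct = F.frac ℤ[V].1# (∏-diff ps) (∏-diff-regular distinct)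
  ... | no  _        = 0#

  Ψ : List V → Carrier
  Ψ w = 1/∏-diff (cyclicSteps w)

  -1^ : ℕ → Carrier
  -1^ k = (- 1#) ^ k

-- A finite list meeting every _~_-class of elements of P exactly once.

record Representatives {A : Set} (P : A → Set p) (_~_ : Rel A ℓ) : Set (p ⊔ ℓ) where
  field
    reps     : List A
    sound    : All P reps
    distinct : AllPairs (λ x y → ¬ (x ~ y)) reps
    complete : ∀ x → P x → Any (x ~_) reps

open Representatives using (reps) public

module Sums {V : Set} (_≟_ : DecidableEquality V) where
  open RationalFunctions _≟_
  open CommutativeRing ℚ⟨V⟩ using (Carrier; _≈_)

  -- The sum of f over P modulo _~_ is s: the index set is finite, and every
  -- choice of representatives gives s.

  SumOver : {A : Set} → (A → Set p) → Rel A ℓ → (A → Carrier) → Carrier → Set (p ⊔ ℓ)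
  SumOver P _~_ f s =
    Representatives P _~_ × ((R : Representatives P _~_) → ∑ (reps R) f ≈ s)

  Ψtor : Quiver V → Carrier → Set₁
  Ψtor Q = SumOver (IsToricExtension Q) _≈rot_ Ψ

data Vertex (k j : ℕ) : Set where
  0̂ 1̂ : Vertex k j
  b   : Fin k → Vertex k j
  c   : Fin j → Vertex k j

module _ {k j : ℕ} where

  _≟ⱽ_ : DecidableEquality (Vertex k j)
  0̂   ≟ⱽ 0̂   = yes ≡.refl
  0̂   ≟ⱽ 1̂   = no λ ()
  0̂   ≟ⱽ b _ = no λ ()
  0̂   ≟ⱽ c _ = no λ ()
  1̂   ≟ⱽ 0̂   = no λ ()
  1̂   ≟ⱽ 1̂   = yes ≡.refl
  1̂   ≟ⱽ b _ = no λ ()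
  1̂   ≟ⱽ c _ = no λ ()
  b _ ≟ⱽ 0̂   = no λ ()
  b _ ≟ⱽ 1̂   = no λ ()
  b r ≟ⱽ b s with r Fin.≟ s
  ... | yes ≡.refl = yes ≡.refl
  ... | no  r≢s    = no λ { ≡.refl → r≢s ≡.refl }
  b _ ≟ⱽ c _ = no λ ()
  c _ ≟ⱽ 0̂   = no λ ()
  c _ ≟ⱽ 1̂   = no λ ()
  c _ ≟ⱽ b _ = no λ ()
  c r ≟ⱽ c s with r Fin.≟ s
  ... | yes ≡.refl = yes ≡.refl
  ... | no  r≢s    = no λ { ≡.refl → r≢s ≡.refl }

module _ (k j : ℕ) where

  𝐛 𝐜 path-b path-c : List (Vertex k j)
  𝐛 = tabulate b
  𝐜 = tabulate c
  path-b = 0̂ ∷ 𝐛 ++ [ 1̂ ]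
  path-c = 0̂ ∷ 𝐜 ++ [ 1̂ ]

  arcs : List (Vertex k j × Vertex k j)
  arcs = steps path-b ++ steps path-c ++ [ (0̂ , 1̂) ]

  private
    open DecMembership (Product.≡-dec (_≟ⱽ_ {k} {j}) (_≟ⱽ_ {k} {j})) using (_∈?_)

    rank : Vertex k j → ℕ
    rank 0̂     = 0
    rank (b r) = suc (toℕ r)
    rank (c s) = suc (toℕ s)
    rank 1̂     = suc (k ℕ.+ j)

    Increasing : Vertex k j × Vertex k j → Set
    Increasing (u , v) = rank u ℕ.< rank v

    path-increasing : ∀ m {n} u (f : Fin n → Vertex k j) → rank u ℕ.≤ m →
      (∀ i → rank (f i) ≡ suc (m ℕ.+ toℕ i)) → m ℕ.+ n ℕ.≤ k ℕ.+ j →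
      All Increasing (steps (u ∷ tabulate f ++ [ 1̂ ]))
    path-increasing m {zero} u f u≤m rank-f m≤ =
      ℕ.s≤s (ℕ.≤-trans u≤m (ℕ.≤-trans (ℕ.m≤m+n m 0) m≤)) ∷ []
    path-increasing m {suc n} u f u≤m rank-f m≤ =
      ≡.subst (rank u ℕ.<_) (≡.sym rank-f0) (ℕ.s≤s u≤m) ∷
      path-increasing (suc m) (f zero) (f ∘ suc) (ℕ.≤-reflexive rank-f0)
        (λ i → ≡.trans (rank-f (suc i)) (≡.cong suc (ℕ.+-suc m (toℕ i))))
        (≡.subst (ℕ._≤ k ℕ.+ j) (ℕ.+-suc m n) m≤)
      where
      rank-f0 : rank (f zero) ≡ suc m
      rank-f0 = ≡.trans (rank-f zero) (≡.cong suc (ℕ.+-identityʳ m))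

    arcs-increasing : All Increasing arcs
    arcs-increasing = All.++⁺
      (path-increasing 0 0̂ b ℕ.z≤n (λ _ → ≡.refl) (ℕ.m≤m+n k j))
      (All.++⁺ (path-increasing 0 0̂ c ℕ.z≤n (λ _ → ≡.refl) (ℕ.m≤n+m j k))
        (ℕ.s≤s ℕ.z≤n ∷ []))

    arc? : Vertex k j → Vertex k j → Bool
    arc? u v = ⌊ (u , v) ∈? arcs ⌋

    arc-increasing : ∀ {u v} → T (arc? u v) → rank u ℕ.< rank v
    arc-increasing {u} {v} uv =
      All.lookup arcs-increasing (toWitness {a? = (u , v) ∈? arcs} uv)

    walk-increasing : ∀ {u v} → TransClosure (λ u v → T (arc? u v)) u v →
      rank u ℕ.< rank v
    walk-increasing [ e ]⁺  = arc-increasing e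
    walk-increasing (e ∷ p) = ℕ.<-trans (arc-increasing e) (walk-increasing p)

  Q : Quiver (Vertex k j)
  Q = record
    { arc     = arc?
    ; acyclic = λ v p → ℕ.<-irrefl ≡.refl (walk-increasing p)
    }

{-# OPTIONS --safe #-}

-- An orientation flip-equivalent to Q has the form given by a height function t : V → ℤ, where
-- t u − t v ∈ {0,1} along each arc u → v of Q, and the arc is reversed exactly when the difference
-- is 1. If 1̂ is a source, the arc 0̂ → 1̂ forces t 0̂ = t 1̂ + 1, so t is constant on each of the two
-- paths up to its last arc; hence the toric extensions of [Q] are the [(1̂, 0̂, 𝐚)] with 𝐚 a shuffle.
-- With G the product of 1/(x_u − x_v) over the steps of a word, induction on the first letter and a
-- partial-fraction identity give ∑ G(z 𝐚 e) = (x_z − x_e) G(z 𝐛 e) G(z 𝐜 e) over the shuffles 𝐚 of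
-- 𝐛 and 𝐜, and the corollary is the case z = 0̂, e = 1̂.

module Submission where

open import Defs
open import Algebra.Bundles using (CommutativeMonoid; CommutativeRing)
import Algebra.Properties.CommutativeSemigroup as CommutativeSemigroupProperties
import Algebra.Properties.Ring as RingProperties
import Algebra.Properties.Semiring.Exp as Exp
import Algebra.Solver.Ring.NaturalCoefficients.Default as SemiringSolver
open import Data.Bool using (Bool; true; false; T; _∧_; _∨_)
import Data.Bool.Properties as Bool
open import Data.Integer as ℤ using (ℤ; 0ℤ; +0; +[1+_]; -[1+_])
import Data.Integer.Properties as ℤ
open import Data.List using (List; []; _∷_; [_]; _++_; foldr; map; reverse; length)
import Data.List.Properties as List
import Data.List.Membership.DecPropositional as DecMembership
open import Data.List.Membership.Propositional using (_∈_; _∉_)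
import Data.List.Membership.Propositional as Membership
open import Data.List.Membership.Propositional.Properties using (∈-map⁺; ∈-map⁻; ∈-++⁺ˡ; ∈-++⁺ʳ; ∈-++⁻; ∈-∃++; ∈-tabulate⁺; ∈-tabulate⁻)
open import Data.List.Membership.Propositional.Properties.WithK using (unique∧set⇒bag)
open import Data.List.Relation.Binary.BagAndSetEquality using (∼bag⇒↭)
open import Data.List.Relation.Binary.Disjoint.Propositional using (Disjoint)
open import Data.List.Relation.Binary.Permutation.Propositional using (_↭_; ↭-refl; ↭-reflexive; ↭-sym; ↭-trans; prep)
import Data.List.Relation.Binary.Permutation.Propositional as ↭
import Data.List.Relation.Binary.Permutation.Propositional.Properties as ↭
open import Data.List.Relation.Binary.Sublist.Propositional using (_⊆_; []; _∷_; _∷ʳ_; minimum; ⊆-refl; lookup)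
import Data.List.Relation.Binary.Sublist.Propositional.Properties as Sublist
open import Data.List.Relation.Unary.All using (All; []; _∷_; all?)
import Data.List.Relation.Unary.All as All
import Data.List.Relation.Unary.All.Properties as All
open import Data.List.Relation.Unary.AllPairs using (AllPairs; []; _∷_)
import Data.List.Relation.Unary.AllPairs as AllPairs
import Data.List.Relation.Unary.AllPairs.Properties as AllPairs
open import Data.List.Relation.Unary.Any using (Any; here; there)
import Data.List.Relation.Unary.Any as Any
import Data.List.Relation.Unary.Any.Properties as Any
open import Data.List.Relation.Unary.Linked using (Linked; []; [-]; _∷_)
import Data.List.Relation.Unary.Linked.Properties as Linked
open import Data.List.Relation.Unary.Unique.Propositional using (Unique)
import Data.List.Relation.Unary.Unique.Propositional.Properties as Unique
open import Data.Nat as ℕ using (ℕ; zero; suc; _≤_; _<_; _<ᵇ_; z≤n; s≤s)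
import Data.Nat.Properties as ℕ
open import Data.Product using (∃; ∃₂; _×_; _,_; proj₁; proj₂; swap; uncurry)
import Data.Product.Properties as Product
open import Data.Rational as ℚ using (ℚ; 0ℚ; 1ℚ; _/_)
import Data.Rational.Properties as ℚ
open import Data.Rational.Unnormalised as ℚᵘ using (mkℚᵘ; *≡*)
import Data.Rational.Unnormalised.Properties as ℚᵘ
open import Data.Sum as Sum using (_⊎_; inj₁; inj₂; [_,_]′)
open import Function using (_∘_; _⇔_; mk⇔; Equivalence; id)
open import Function.Properties.Equivalence using () renaming (sym to ⇔-sym; trans to ⇔-trans)
open import Level using (Level; 0ℓ)
open import Relation.Binary.Construct.Closure.ReflexiveTransitive as Star using (_◅_; _◅◅_)
open import Relation.Binary.Construct.Closure.Transitive using (TransClosure) renaming ([_] to [_]⁺; _∷_ to _∷⁺_)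
open import Relation.Binary.Core using (Rel)
open import Relation.Binary.Definitions using (DecidableEquality; Symmetric; Transitive; tri<; tri≈; tri>)
open import Relation.Binary.PropositionalEquality as ≡ using (_≡_; _≢_)
open import Relation.Nullary using (¬_; Dec; yes; no; ¬?; contradiction)
open import Relation.Nullary.Decidable using (toWitness; fromWitness)

open ℝ
open Equivalence using (to; from)

-- Flip sequences have unbounded length, so ruling out words takes an invariant: a height function
-- survives every flip, and its differences along arcs are all that is used later. Inclusion of
-- chambers quantifies over real points, yet both directions become combinatorial. Representatives
-- in [0,1) are unique up to `≃ᴿ`, so a single rational point detects the orientation that a word
-- induces; conversely, the orientation at any point of an order chamber is read off a rotation of
-- the word. Rotating a word by one letter is a flip at a source, which ties the two kinds of toric
-- class together. Putting 1̂ first selects one word from each class, and a single flip of `Q`, at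
-- its sink 1̂, reaches the orientations by these words. The sign comes from closing up: the step
-- from 1̂ to 0̂ cancels the factor x_0̂ - x_1̂ up to -1, and reversing the k + 1 steps of the
-- 𝐛-path gives the remaining signs.

private variable
  a ℓ₁ ℓ : Level
  A : Set a
  V : Set

-- Steps of a word, and lists up to permutation

steps-++ : (xs : List A) (y : A) (ys : List A) →
  steps (xs ++ y ∷ ys) ≡ steps (xs ++ [ y ]) ++ steps (y ∷ ys)
steps-++ []            y ys = ≡.refl
steps-++ (x ∷ [])      y ys = ≡.refl
steps-++ (x ∷ x′ ∷ xs) y ys = ≡.cong ((x , x′) ∷_) (steps-++ (x′ ∷ xs) y ys)

steps-reverse : (xs : List A) → steps (reverse xs) ↭ map swap (steps xs)
steps-reverse []           = ↭-refl
steps-reverse (x ∷ [])     = ↭-refl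
steps-reverse (x ∷ y ∷ xs) = ↭-trans (↭-reflexive snoc) (↭-trans (↭-sym (↭.∷↭∷ʳ (y , x) _))
  (prep (y , x) (steps-reverse (y ∷ xs))))
  where
  open ≡.≡-Reasoning
  snoc : steps (reverse (x ∷ y ∷ xs)) ≡ steps (reverse (y ∷ xs)) ++ [ (y , x) ]
  snoc = begin
    steps (reverse (x ∷ y ∷ xs))
      ≡⟨ ≡.cong steps (List.unfold-reverse x (y ∷ xs)) ⟩
    steps (reverse (y ∷ xs) ++ [ x ])
      ≡⟨ ≡.cong (λ r → steps (r ++ [ x ])) (List.unfold-reverse y xs) ⟩
    steps ((reverse xs ++ [ y ]) ++ [ x ])
      ≡⟨ ≡.cong steps (List.++-assoc (reverse xs) [ y ] [ x ]) ⟩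
    steps (reverse xs ++ y ∷ x ∷ [])
      ≡⟨ steps-++ (reverse xs) y [ x ] ⟩
    steps (reverse xs ++ [ y ]) ++ [ (y , x) ]
      ≡⟨ ≡.cong (λ r → steps r ++ [ (y , x) ]) (List.unfold-reverse y xs) ⟨
    steps (reverse (y ∷ xs)) ++ [ (y , x) ]
      ∎

-- Moving the head to the end only carries its step to the end of the list. A product over the steps
-- ignores their order, which is why `Ψ` is well defined on toric total orders.
cyclicSteps-rotate : (w : List A) → cyclicSteps (rotate w) ↭ cyclicSteps w
cyclicSteps-rotate []           = ↭-refl
cyclicSteps-rotate (x ∷ [])     = ↭-refl
cyclicSteps-rotate (x ∷ y ∷ ys) = ↭-trans (↭-reflexive snoc) (↭-sym (↭.∷↭∷ʳ (x , y) _))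
  where
  snoc : steps (y ∷ (ys ++ [ x ]) ++ [ y ]) ≡ steps (y ∷ ys ++ [ x ]) ++ [ (x , y) ]
  snoc = ≡.trans (≡.cong (steps ∘ (y ∷_)) (List.++-assoc ys [ x ] [ y ]))
                 (steps-++ (y ∷ ys) x [ y ])

AllPairs⇒steps : ∀ {R : Rel A ℓ} {xs} → AllPairs R xs → All (uncurry R) (steps xs)
AllPairs⇒steps []                     = []
AllPairs⇒steps (_ ∷ [])               = []
AllPairs⇒steps ((r ∷ _) ∷ rs@(_ ∷ _)) = r ∷ AllPairs⇒steps rs

AllPairs-resp-⊆ : ∀ {R : Rel A ℓ} {xs ys} → xs ⊆ ys → AllPairs R ys → AllPairs R xs
AllPairs-resp-⊆ []           []       = []
AllPairs-resp-⊆ (_ ∷ʳ s)     (_ ∷ rs) = AllPairs-resp-⊆ s rs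
AllPairs-resp-⊆ (≡.refl ∷ s) (r ∷ rs) = Sublist.All-resp-⊆ s r ∷ AllPairs-resp-⊆ s rs

AllPairs-resp-↭ : ∀ {R : Rel A ℓ} → Symmetric R → ∀ {xs ys} → xs ↭ ys → AllPairs R xs → AllPairs R ys
AllPairs-resp-↭ R-sym ↭.refl         rs                     = rs
AllPairs-resp-↭ R-sym (↭.prep x p)   (r ∷ rs)               =
  ↭.All-resp-↭ p r ∷ AllPairs-resp-↭ R-sym p rs
AllPairs-resp-↭ R-sym (↭.swap x y p) ((r ∷ rx) ∷ (ry ∷ rs)) =
  (R-sym r ∷ ↭.All-resp-↭ p ry) ∷ ↭.All-resp-↭ p rx ∷ AllPairs-resp-↭ R-sym p rs
AllPairs-resp-↭ R-sym (↭.trans p q)  rs                     =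
  AllPairs-resp-↭ R-sym q (AllPairs-resp-↭ R-sym p rs)

AllPairs-zipˡ : ∀ {P : A → Set ℓ₁} {R : Rel A ℓ} {xs} → All P xs → AllPairs R xs →
  AllPairs (λ x y → P x × R x y) xs
AllPairs-zipˡ []       []       = []
AllPairs-zipˡ (p ∷ ps) (r ∷ rs) = All.map (p ,_) r ∷ AllPairs-zipˡ ps rs

steps⇒Linked : ∀ {R : Rel A ℓ} xs → All (uncurry R) (steps xs) → Linked R xs
steps⇒Linked []           _        = []
steps⇒Linked (x ∷ [])     _        = [-]
steps⇒Linked (x ∷ y ∷ xs) (r ∷ rs) = r ∷ steps⇒Linked (y ∷ xs) rs

IsPermutation-↭ : ∀ {w w′ : List V} → IsPermutation w → IsPermutation w′ → w ↭ w′
IsPermutation-↭ (u , full) (u′ , full′) =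
  ∼bag⇒↭ (unique∧set⇒bag u u′ (mk⇔ (λ _ → full′ _) (λ _ → full _)))

-- Shuffles

shuffles : List A → List A → List (List A)
shuffles []       ys       = [ ys ]
shuffles (x ∷ xs) []       = [ x ∷ xs ]
shuffles (x ∷ xs) (y ∷ ys) = map (x ∷_) (shuffles xs (y ∷ ys)) ++ map (y ∷_) (shuffles (x ∷ xs) ys)

shuffles-sound : (xs ys : List A) → All (IsShuffle xs ys) (shuffles xs ys)
shuffles-sound []       ys       = (↭-refl , minimum ys , ⊆-refl) ∷ []
shuffles-sound (x ∷ xs) []       =
  (↭-reflexive (≡.sym (List.++-identityʳ (x ∷ xs))) , ⊆-refl , minimum (x ∷ xs)) ∷ []
shuffles-sound (x ∷ xs) (y ∷ ys) = All.++⁺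
  (All.map⁺ (All.map (λ (p , s , t) → prep x p , ≡.refl ∷ s , x ∷ʳ t) (shuffles-sound xs (y ∷ ys))))
  (All.map⁺ (All.map (λ (p , s , t) →
      ↭-trans (prep y p) (↭-sym (↭.shift y (x ∷ xs) ys)) , y ∷ʳ s , ≡.refl ∷ t)
    (shuffles-sound (x ∷ xs) ys)))

∷-∈-shufflesˡ : ∀ {as} x (xs ys : List A) → as ∈ shuffles xs ys → x ∷ as ∈ shuffles (x ∷ xs) ys
∷-∈-shufflesˡ x []        []       (here ≡.refl) = here ≡.refl
∷-∈-shufflesˡ x (x′ ∷ xs) []       (here ≡.refl) = here ≡.refl
∷-∈-shufflesˡ x xs        (y ∷ ys) as∈           = ∈-++⁺ˡ (∈-map⁺ (x ∷_) as∈)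

∷-∈-shufflesʳ : ∀ {as} y (xs ys : List A) → as ∈ shuffles xs ys → y ∷ as ∈ shuffles xs (y ∷ ys)
∷-∈-shufflesʳ y []       ys (here ≡.refl) = here ≡.refl
∷-∈-shufflesʳ y (x ∷ xs) ys as∈           = ∈-++⁺ʳ _ (∈-map⁺ (y ∷_) as∈)

-- Since `x` does not recur in `as`, an embedding of a list containing `x` cannot skip the head; it
-- must match it with the first entry of `xs`.
⊆-∷⁻ : ∀ {x : A} {xs as} → x ∉ as → x ∈ xs → xs ⊆ x ∷ as → ∃ λ xs′ → xs ≡ x ∷ xs′ × xs′ ⊆ as
⊆-∷⁻ x∉as x∈xs (_ ∷ʳ s)     = contradiction (lookup s x∈xs) x∉as
⊆-∷⁻ x∉as x∈xs (≡.refl ∷ s) = _ , ≡.refl , s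

⊆-drop : ∀ {x : A} {xs as} → x ∉ xs → xs ⊆ x ∷ as → xs ⊆ as
⊆-drop x∉xs (_ ∷ʳ s)     = s
⊆-drop x∉xs (≡.refl ∷ s) = contradiction (here ≡.refl) x∉xs

-- The head of a shuffle lies in one of the two words and, by `⊆-∷⁻`, is the first letter there.
-- Disjointness keeps it out of the other word, whose embedding therefore survives its removal.
shuffles-complete : ∀ {as xs ys : List A} → Unique as → Disjoint xs ys →
  IsShuffle xs ys as → as ∈ shuffles xs ys
shuffles-complete {as = []} {[]} {[]} _ _ _ = here ≡.refl
shuffles-complete {as = []} {[]} {_ ∷ _} _ _ (_ , _ , ())
shuffles-complete {as = []} {_ ∷ _} _ _ (_ , () , _)
shuffles-complete {as = a ∷ as} {xs} {ys} u@(_ ∷ u′) dis (p , s , t)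
  with ∈-++⁻ xs (↭.∈-resp-↭ p (here ≡.refl))
... | inj₁ a∈xs with xs′ , ≡.refl , s′ ← ⊆-∷⁻ (Unique.Unique[x∷xs]⇒x∉xs u) a∈xs s =
  ∷-∈-shufflesˡ a xs′ ys (shuffles-complete u′ (λ (i , j) → dis (there i , j))
    (↭.drop-∷ p , s′ , ⊆-drop (λ a∈ys → dis (a∈xs , a∈ys)) t))
... | inj₂ a∈ys with ys′ , ≡.refl , t′ ← ⊆-∷⁻ (Unique.Unique[x∷xs]⇒x∉xs u) a∈ys t =
  ∷-∈-shufflesʳ a xs ys′ (shuffles-complete u′ (λ (i , j) → dis (i , there j))
    (↭.drop-∷ (↭-trans p (↭.shift a xs ys′)) , ⊆-drop (λ a∈xs → dis (a∈xs , a∈ys)) s , t′))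

-- Disjointness separates `x` from `y`, so the lists produced by the two halves of the recursion
-- already differ in their heads.
shuffles-unique : {xs ys : List A} → Disjoint xs ys → Unique (shuffles xs ys)
shuffles-unique {xs = []}               _   = [] ∷ []
shuffles-unique {xs = _ ∷ _} {[]}       _   = [] ∷ []
shuffles-unique {xs = x ∷ xs} {y ∷ ys} dis = Unique.++⁺
  (Unique.map⁺ List.∷-injectiveʳ (shuffles-unique (λ (i , j) → dis (there i , j))))
  (Unique.map⁺ List.∷-injectiveʳ (shuffles-unique (λ (i , j) → dis (i , there j))))
  λ (i , j) → let _ , _ , eq₁ = ∈-map⁻ (x ∷_) i
                  _ , _ , eq₂ = ∈-map⁻ (y ∷_) j
              in dis (here ≡.refl , here (List.∷-injectiveˡ (≡.trans (≡.sym eq₁) eq₂)))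

-- Sums and products over finite lists

module Fold {ℓ₁ ℓ₂} (M : CommutativeMonoid ℓ₁ ℓ₂) where
  open CommutativeMonoid M
  open CommutativeSemigroupProperties commutativeSemigroup using (x∙yz≈y∙xz)

  fold : List A → (A → Carrier) → Carrier
  fold as f = foldr (λ a s → f a ∙ s) ε as

  fold-++ : (as bs : List A) (f : A → Carrier) → fold (as ++ bs) f ≈ fold as f ∙ fold bs f
  fold-++ []       bs f = sym (identityˡ _)
  fold-++ (a ∷ as) bs f = trans (∙-congˡ (fold-++ as bs f)) (sym (assoc _ _ _))

  fold-map : ∀ {B : Set} (h : B → A) (as : List B) (f : A → Carrier) →
    fold (map h as) f ≡ fold as (f ∘ h)
  fold-map h []       f = ≡.refl
  fold-map h (a ∷ as) f = ≡.cong (f (h a) ∙_) (fold-map h as f)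

  fold-cong : (as : List A) {f g : A → Carrier} → (∀ a → f a ≈ g a) → fold as f ≈ fold as g
  fold-cong []       f≈g = refl
  fold-cong (a ∷ as) f≈g = ∙-cong (f≈g a) (fold-cong as f≈g)

  fold-resp-↭ : ∀ {as bs : List A} (f : A → Carrier) → as ↭ bs → fold as f ≈ fold bs f
  fold-resp-↭ f ↭.refl         = refl
  fold-resp-↭ f (↭.prep a p)   = ∙-congˡ (fold-resp-↭ f p)
  fold-resp-↭ f (↭.swap a β p) = trans (x∙yz≈y∙xz _ _ _) (∙-congˡ (∙-congˡ (fold-resp-↭ f p)))
  fold-resp-↭ f (↭.trans p q)  = trans (fold-resp-↭ f p) (fold-resp-↭ f q)

  module _ {A : Set} {P : A → Set ℓ} {_~_ : Rel A 0ℓ} (~-sym : Symmetric _~_)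
           (~-trans : Transitive _~_) {f : A → Carrier}
           (f-cong : ∀ {x y} → P x → x ~ y → f x ≈ f y) where

    -- The partner `y` of the first entry `x` is permuted to the front of `ys` and both are removed.
    -- The remaining lists still match: an entry whose partner was removed would be related to `x`
    -- or `y` through that partner, against distinctness.
    fold-transversal : ∀ {xs ys} → All P xs →
      AllPairs (λ x y → ¬ (x ~ y)) xs → AllPairs (λ x y → ¬ (x ~ y)) ys →
      All (λ x → Any (x ~_) ys) xs → All (λ y → Any (y ~_) xs) ys →
      fold xs f ≈ fold ys f
    fold-transversal {[]} {[]}    _ _ _ _ _ = refl
    fold-transversal {[]} {_ ∷ _} _ _ _ _ (() ∷ _)
    fold-transversal {x ∷ xs} (px ∷ pxs) (x≁xs ∷ dxs) dys (x~ys ∷ xs~ys) ys~xs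
      with y , y∈ys , x~y ← Membership.find x~ys
      with ys₁ , ys₂ , ≡.refl ← ∈-∃++ y∈ys
      with y≁ys ∷ dys′ ← AllPairs-resp-↭ (_∘ ~-sym) (↭.shift y ys₁ ys₂) dys
         | _ ∷ ys~xs′ ← ↭.All-resp-↭ (↭.shift y ys₁ ys₂) ys~xs =
      trans (∙-cong (f-cong px x~y) (fold-transversal pxs dxs dys′
               (All.zipWith (λ (x≁x′ , x′~) → drop-y x≁x′ (↭.Any-resp-↭ (↭.shift y ys₁ ys₂) x′~))
                 (x≁xs , xs~ys))
               (All.zipWith (λ (y≁y′ , y′~) → drop-x y≁y′ y′~) (y≁ys , ys~xs′))))
            (sym (fold-resp-↭ f (↭.shift y ys₁ ys₂)))
      where
      drop-y : ∀ {x′ zs} → ¬ (x ~ x′) → Any (x′ ~_) (y ∷ zs) → Any (x′ ~_) zs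
      drop-y x≁x′ (here x′~y)  = contradiction (~-trans x~y (~-sym x′~y)) x≁x′
      drop-y x≁x′ (there x′~z) = x′~z
      drop-x : ∀ {y′} → ¬ (y ~ y′) → Any (y′ ~_) (x ∷ xs) → Any (y′ ~_) xs
      drop-x y≁y′ (here y′~x)  = contradiction (~-trans (~-sym x~y) (~-sym y′~x)) y≁y′
      drop-x y≁y′ (there y′~z) = y′~z

    -- This is the independence of representatives in `SumOver`: evaluating one convenient choice
    -- settles all of them.
    fold-reps : (R S : Representatives P _~_) → fold (reps R) f ≈ fold (reps S) f
    fold-reps R S = fold-transversal R.sound R.distinct S.distinct
      (All.map (S.complete _) R.sound) (All.map (R.complete _) S.sound)
      where
      module R = Representatives R
      module S = Representatives S

-- The shuffle identity in a commutative ring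

ReciprocalDifference : (K : CommutativeRing ℓ₁ ℓ) →
  (V → CommutativeRing.Carrier K) → (V → V → CommutativeRing.Carrier K) → Set ℓ
ReciprocalDifference K x g = ∀ {u v} → u ≢ v → (x u - x v) * g u v ≈ 1#
  where open CommutativeRing K

-- Treating the reciprocals as given ring elements `g u v` keeps denominators out of the induction:
-- fractions enter only through the relation `g-inverse`.
module ShuffleIdentity {ℓ₁ ℓ₂} (K : CommutativeRing ℓ₁ ℓ₂) {V : Set}
  (x : V → CommutativeRing.Carrier K) (g : V → V → CommutativeRing.Carrier K)
  (g-inverse : ReciprocalDifference K x g) where

  open CommutativeRing K
  open RingProperties ring
    using (-‿distribˡ-*; -‿distribʳ-*; -‿involutive; -1*x≈-x; -‿anti-homo-+)
  open SemiringSolver commutativeSemiring using (solve; _:=_; _:+_; _:*_; con)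
  open Exp semiring using (_^_)
  open Fold +-commutativeMonoid public using ()
    renaming (fold to ∑; fold-++ to ∑-++; fold-map to ∑-map; fold-cong to ∑-cong)
  open Fold *-commutativeMonoid public using ()
    renaming (fold to ∏; fold-++ to ∏-++; fold-resp-↭ to ∏-resp-↭)
  open import Relation.Binary.Reasoning.Setoid setoid

  G : List (V × V) → Carrier
  G ps = ∏ ps (uncurry g)

  private
    d : V → V → Carrier
    d u v = x u - x v

  d-split : ∀ u v w → d u v + d v w ≈ d u w
  d-split u v w = begin
    (x u - x v) + (x v - x w)    ≈⟨ solve 4 (λ u v v′ w →
        (u :+ v′) :+ (v :+ w) := (u :+ w) :+ (v′ :+ v)) refl (x u) (x v) (- x v) (- x w) ⟩
    (x u - x w) + (- x v + x v)  ≈⟨ +-congˡ (-‿inverseˡ (x v)) ⟩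
    (x u - x w) + 0#             ≈⟨ +-identityʳ _ ⟩
    x u - x w                    ∎

  d-swap : ∀ u v → d v u ≈ - d u v
  d-swap u v = begin
    x v - x u        ≈⟨ +-congʳ (-‿involutive (x v)) ⟨
    - - x v - x u    ≈⟨ -‿anti-homo-+ (x u) (- x v) ⟨
    - (x u - x v)    ∎

  g-swap : ∀ {u v} → u ≢ v → g v u ≈ - g u v
  g-swap {u} {v} u≢v = begin
    g v u                        ≈⟨ *-identityˡ _ ⟨
    1# * g v u                   ≈⟨ *-congʳ (g-inverse u≢v) ⟨
    d u v * g u v * g v u        ≈⟨ solve 3 (λ d g h → d :* g :* h := g :* (d :* h)) refl _ _ _ ⟩
    g u v * (d u v * g v u)      ≈⟨ *-congˡ (*-congʳ (d-swap v u)) ⟩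
    g u v * (- d v u * g v u)    ≈⟨ *-congˡ (-‿distribˡ-* _ _) ⟨
    g u v * - (d v u * g v u)    ≈⟨ *-congˡ (-‿cong (g-inverse (u≢v ∘ ≡.sym))) ⟩
    g u v * - 1#                 ≈⟨ -‿distribʳ-* _ _ ⟨
    - (g u v * 1#)               ≈⟨ -‿cong (*-identityʳ _) ⟩
    - g u v                      ∎

  g-inverse-swap : ∀ {u v} → u ≢ v → d v u * g u v ≈ - 1#
  g-inverse-swap {u} {v} u≢v = begin
    d v u * g u v        ≈⟨ *-congʳ (d-swap u v) ⟩
    - d u v * g u v      ≈⟨ -‿distribˡ-* _ _ ⟨
    - (d u v * g u v)    ≈⟨ -‿cong (g-inverse u≢v) ⟩
    - 1#                 ∎

  -1^*-1^ : ∀ k → (- 1#) ^ k * (- 1#) ^ k ≈ 1#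
  -1^*-1^ zero    = *-identityˡ 1#
  -1^*-1^ (suc k) = begin
    (- 1# * m) * (- 1# * m)    ≈⟨ solve 2 (λ a m →
        (a :* m) :* (a :* m) := (a :* a) :* (m :* m)) refl (- 1#) m ⟩
    (- 1# * - 1#) * (m * m)    ≈⟨ *-cong (trans (-1*x≈-x (- 1#)) (-‿involutive 1#)) (-1^*-1^ k) ⟩
    1# * 1#                    ≈⟨ *-identityˡ 1# ⟩
    1#                         ∎
    where m = (- 1#) ^ k

  G-swap : ∀ {ps} → All (uncurry _≢_) ps → G (map swap ps) ≈ (- 1#) ^ length ps * G ps
  G-swap []                         = sym (*-identityˡ 1#)
  G-swap {(u , v) ∷ ps} (u≢v ∷ dis) = begin
    g v u * G (map swap ps)      ≈⟨ *-cong (g-swap u≢v) (G-swap dis) ⟩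
    - g u v * (m * G ps)         ≈⟨ *-congʳ (-1*x≈-x (g u v)) ⟨
    - 1# * g u v * (m * G ps)    ≈⟨ solve 4 (λ a g m p →
        a :* g :* (m :* p) := a :* m :* (g :* p)) refl (- 1#) (g u v) m (G ps) ⟩
    - 1# * m * (g u v * G ps)    ∎
    where m = (- 1#) ^ length ps

  ∑-distribˡ : ∀ {A : Set} k (as : List A) (f : A → Carrier) → ∑ as (λ a → k * f a) ≈ k * ∑ as f
  ∑-distribˡ k []       f = sym (zeroʳ k)
  ∑-distribˡ k (a ∷ as) f = trans (+-congˡ (∑-distribˡ k as f)) (sym (distribˡ k (f a) (∑ as f)))

  -- In terms of u = z − β, v = β − γ and s = γ − e the identity is one of semirings.
  partial-fractions : ∀ {z β γ} e → z ≢ β → z ≢ γ → β ≢ γ →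
    g z β * (d β e * g β γ) + g z γ * (d γ e * g γ β) ≈ d z e * (g z β * g z γ)
  partial-fractions {z} {β} {γ} e z≢β z≢γ β≢γ = begin
    p * (d β e * r) + q * (s * g γ β)
      ≈⟨ +-cong left (*-congˡ (*-congˡ (g-swap β≢γ))) ⟩
    ((u + v + s) * (p * q) + q * (s * r)) + q * (s * - r)
      ≈⟨ solve 5 (λ m q s r n → (m :+ q :* (s :* r)) :+ q :* (s :* n) := m :+ q :* s :* (r :+ n))
           refl ((u + v + s) * (p * q)) q s r (- r) ⟩
    (u + v + s) * (p * q) + q * s * (r - r)
      ≈⟨ +-congˡ (trans (*-congˡ (-‿inverseʳ r)) (zeroʳ _)) ⟩
    (u + v + s) * (p * q) + 0#
      ≈⟨ +-identityʳ _ ⟩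
    (u + v + s) * (p * q)
      ≈⟨ *-congʳ (trans (+-congʳ (d-split z β γ)) (d-split z γ e)) ⟩
    d z e * (p * q)
      ∎
    where
    p = g z β
    q = g z γ
    r = g β γ
    u = d z β
    v = d β γ
    s = d γ e
    left : p * (d β e * r) ≈ (u + v + s) * (p * q) + q * (s * r)
    left = begin
      p * (d β e * r)
        ≈⟨ *-identityʳ _ ⟨
      p * (d β e * r) * 1#
        ≈⟨ *-cong (*-congˡ (*-congʳ (sym (d-split β γ e))))
                  (sym (trans (*-congʳ (d-split z β γ)) (g-inverse z≢γ))) ⟩
      p * ((v + s) * r) * ((u + v) * q)
        ≈⟨ solve 6 (λ p q r u v s → p :* ((v :+ s) :* r) :* ((u :+ v) :* q) :=
             (v :* r) :* ((u :+ v :+ s) :* (p :* q)) :+ (u :* p) :* (q :* (s :* r)))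
             refl p q r u v s ⟩
      (v * r) * ((u + v + s) * (p * q)) + (u * p) * (q * (s * r))
        ≈⟨ +-cong (*-congʳ (g-inverse β≢γ)) (*-congʳ (g-inverse z≢β)) ⟩
      1# * ((u + v + s) * (p * q)) + 1# * (q * (s * r))
        ≈⟨ +-cong (*-identityˡ _) (*-identityˡ _) ⟩
      (u + v + s) * (p * q) + q * (s * r)
        ∎

  -- The end `e` stays fixed while the start `z` moves, so deleting the first letter of a shuffle
  -- leaves a sum of the same form. With an empty word, `d z e` cancels the one-step path from `z`
  -- to `e`; otherwise both halves contain `B * C`, and `partial-fractions` merges their
  -- coefficients.
  ∑-shuffles : ∀ e z bs cs → Unique (e ∷ z ∷ bs ++ cs) →
    ∑ (shuffles bs cs) (λ as → G (steps (z ∷ as ++ [ e ]))) ≈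
    d z e * (G (steps (z ∷ bs ++ [ e ])) * G (steps (z ∷ cs ++ [ e ])))
  ∑-shuffles e z [] cs ((e≢z ∷ _) ∷ _) = begin
    C + 0#                           ≈⟨ +-identityʳ C ⟩
    C                                ≈⟨ *-identityˡ C ⟨
    1# * C                           ≈⟨ *-congʳ (g-inverse (e≢z ∘ ≡.sym)) ⟨
    d z e * g z e * C                ≈⟨ solve 3 (λ d g y →
        d :* g :* y := d :* ((g :* con 1) :* y)) refl (d z e) (g z e) C ⟩
    d z e * ((g z e * 1#) * C)       ∎
    where C = G (steps (z ∷ cs ++ [ e ]))
  ∑-shuffles e z (β ∷ bs) [] ((e≢z ∷ _) ∷ _) = begin
    B + 0#                           ≈⟨ +-identityʳ B ⟩
    B                                ≈⟨ *-identityˡ B ⟨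
    1# * B                           ≈⟨ *-congʳ (g-inverse (e≢z ∘ ≡.sym)) ⟨
    d z e * g z e * B                ≈⟨ solve 3 (λ d g y →
        d :* g :* y := d :* (y :* (g :* con 1))) refl (d z e) (g z e) B ⟩
    d z e * (B * (g z e * 1#))       ∎
    where B = G (steps (z ∷ β ∷ bs ++ [ e ]))
  ∑-shuffles e z (β ∷ bs) (γ ∷ cs) uniq@((e≢z ∷ e∉) ∷ (z≢β ∷ z∉) ∷ (β∉ ∷ u)) = begin
    ∑ (map (β ∷_) Sβ ++ map (γ ∷_) Sγ) (F z)
      ≈⟨ ∑-++ (map (β ∷_) Sβ) (map (γ ∷_) Sγ) (F z) ⟩
    ∑ (map (β ∷_) Sβ) (F z) + ∑ (map (γ ∷_) Sγ) (F z)
      ≡⟨ ≡.cong₂ _+_ (∑-map (β ∷_) Sβ (F z)) (∑-map (γ ∷_) Sγ (F z)) ⟩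
    ∑ Sβ (λ as → g z β * F β as) + ∑ Sγ (λ as → g z γ * F γ as)
      ≈⟨ +-cong (∑-distribˡ (g z β) Sβ (F β)) (∑-distribˡ (g z γ) Sγ (F γ)) ⟩
    g z β * ∑ Sβ (F β) + g z γ * ∑ Sγ (F γ)
      ≈⟨ +-cong (*-congˡ (∑-shuffles e β bs (γ ∷ cs) (e∉ ∷ β∉ ∷ u)))
                (*-congˡ (∑-shuffles e γ (β ∷ bs) cs uniq′)) ⟩
    g z β * (d β e * (B * (g β γ * C))) + g z γ * (d γ e * ((g γ β * B) * C))
      ≈⟨ solve 8 (λ p m r q n t B C →
           p :* (m :* (B :* (r :* C))) :+ q :* (n :* ((t :* B) :* C)) :=
           (p :* (m :* r) :+ q :* (n :* t)) :* (B :* C))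
           refl (g z β) (d β e) (g β γ) (g z γ) (d γ e) (g γ β) B C ⟩
    (g z β * (d β e * g β γ) + g z γ * (d γ e * g γ β)) * (B * C)
      ≈⟨ *-congʳ (partial-fractions e z≢β (All.lookup z∉ γ∈) (All.lookup β∉ γ∈)) ⟩
    d z e * (g z β * g z γ) * (B * C)
      ≈⟨ solve 5 (λ d p q B C → d :* (p :* q) :* (B :* C) := d :* ((p :* B) :* (q :* C)))
           refl (d z e) (g z β) (g z γ) B C ⟩
    d z e * ((g z β * B) * (g z γ * C))
      ∎
    where
    Sβ = shuffles bs (γ ∷ cs)
    Sγ = shuffles (β ∷ bs) cs
    F : V → List V → Carrier
    F v as = G (steps (v ∷ as ++ [ e ]))
    B = G (steps (β ∷ bs ++ [ e ]))
    C = G (steps (γ ∷ cs ++ [ e ]))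
    γ∈ : γ ∈ bs ++ γ ∷ cs
    γ∈ = ∈-++⁺ʳ bs (here ≡.refl)
    uniq′ : Unique (e ∷ γ ∷ β ∷ bs ++ cs)
    uniq′ = AllPairs-resp-↭ (_∘ ≡.sym) (prep e (↭.shift γ (β ∷ bs) cs)) (e∉ ∷ β∉ ∷ u)

  length-steps : ∀ {A : Set} (a : A) (as : List A) → length (steps (a ∷ as)) ≡ length as
  length-steps a []        = ≡.refl
  length-steps a (a′ ∷ as) = ≡.cong suc (length-steps a′ as)

  -- Closing the path adds the step from `e` to `z`, whose reciprocal cancels the factor `d z e` of
  -- `∑-shuffles` up to -1.
  ∑-cyclic-shuffles : ∀ e z bs cs → Unique (e ∷ z ∷ bs ++ cs) →
    ∑ (shuffles bs cs) (λ as → G (cyclicSteps (e ∷ z ∷ as))) ≈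
    (- 1#) ^ length bs * G (map swap (steps (z ∷ bs ++ [ e ])) ++ steps (z ∷ cs ++ [ e ]))
  ∑-cyclic-shuffles e z bs cs uniq@((e≢z ∷ e∉) ∷ (z∉ ∷ u)) = begin
    ∑ (shuffles bs cs) (λ as → g e z * G (steps (z ∷ as ++ [ e ])))
      ≈⟨ ∑-distribˡ (g e z) (shuffles bs cs) (λ as → G (steps (z ∷ as ++ [ e ]))) ⟩
    g e z * ∑ (shuffles bs cs) (λ as → G (steps (z ∷ as ++ [ e ])))
      ≈⟨ *-congˡ (∑-shuffles e z bs cs uniq) ⟩
    g e z * (d z e * (B * C))
      ≈⟨ solve 4 (λ g d B C → g :* (d :* (B :* C)) := d :* g :* (B :* C)) refl (g e z) (d z e) B C ⟩
    d z e * g e z * (B * C)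
      ≈⟨ *-congʳ (g-inverse-swap e≢z) ⟩
    - 1# * (B * C)
      ≈⟨ *-identityˡ _ ⟨
    1# * (- 1# * (B * C))
      ≈⟨ *-congʳ (-1^*-1^ (length bs)) ⟨
    -- One `m` stays outside as the final sign; the other joins `- 1#` to form the sign of reversing
    -- the `length bs + 1` steps of the path through `bs`.
    m * m * (- 1# * (B * C))
      ≈⟨ solve 4 (λ m n B C → m :* m :* (n :* (B :* C)) := m :* (n :* m :* B :* C))
           refl m (- 1#) B C ⟩
    m * ((- 1#) ^ suc (length bs) * B * C)
      ≡⟨ ≡.cong (λ l → m * ((- 1#) ^ l * B * C)) length-path ⟨
    m * ((- 1#) ^ length (steps (z ∷ bs ++ [ e ])) * B * C)
      ≈⟨ *-congˡ (*-congʳ (G-swap (AllPairs⇒steps path-unique))) ⟨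
    m * (G (map swap (steps (z ∷ bs ++ [ e ]))) * C)
      ≈⟨ *-congˡ (∏-++ (map swap (steps (z ∷ bs ++ [ e ]))) (steps (z ∷ cs ++ [ e ])) (uncurry g)) ⟨
    m * G (map swap (steps (z ∷ bs ++ [ e ])) ++ steps (z ∷ cs ++ [ e ]))
      ∎
    where
    m = (- 1#) ^ length bs
    B = G (steps (z ∷ bs ++ [ e ]))
    C = G (steps (z ∷ cs ++ [ e ]))
    length-path : length (steps (z ∷ bs ++ [ e ])) ≡ suc (length bs)
    length-path = ≡.trans (length-steps z (bs ++ [ e ]))
      (≡.trans (List.length-++ bs) (ℕ.+-comm (length bs) 1))
    path-unique : Unique (z ∷ bs ++ [ e ])
    path-unique = AllPairs-resp-↭ (_∘ ≡.sym) (↭.∷↭∷ʳ e (z ∷ bs))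
      (AllPairs-resp-⊆ (≡.refl ∷ ≡.refl ∷ Sublist.++⁺ʳ cs ⊆-refl) uniq)

-- Rational functions

module PartialFractions {V : Set} (_≟_ : DecidableEquality V) where
  open Polynomials V using (X; polyRing)
  private module ℤ[V] = CommutativeRing polyRing
  open Fractions polyRing using (frac; eq; 1-regular)
  open SemiringSolver ℤ[V].commutativeSemiring using (solve; _:=_; _:+_; _:*_; con)
  open RationalFunctions _≟_
  open CommutativeRing ℚ⟨V⟩

  1/∏-diff-distinct : ∀ {ps} (dis : All (uncurry _≢_) ps) →
    1/∏-diff ps ≈ frac ℤ[V].1# (∏-diff ps) (∏-diff-regular dis)
  1/∏-diff-distinct {ps} dis with all? (λ (u , v) → ¬? (u ≟ v)) ps
  ... | yes _   = eq ℤ[V].refl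
  ... | no ¬dis = contradiction dis ¬dis

  1/∏-diff-degenerate : ∀ {ps} → ¬ All (uncurry _≢_) ps → 1/∏-diff ps ≈ 0#
  1/∏-diff-degenerate {ps} ¬dis with all? (λ (u , v) → ¬? (u ≟ v)) ps
  ... | yes dis = contradiction dis ¬dis
  ... | no  _   = eq ℤ[V].refl

  x : V → Carrier
  x v = frac (X v) ℤ[V].1# 1-regular

  g : V → V → Carrier
  g u v = 1/∏-diff [ (u , v) ]

  g-inverse : ∀ {u v} → u ≢ v → (x u - x v) * g u v ≈ 1#
  g-inverse {u} {v} u≢v = trans {(x u - x v) * g u v} {(x u - x v) * g′} {1#}
    (*-congˡ {x u - x v} {g u v} {g′} (1/∏-diff-distinct (u≢v ∷ [])))
    (eq (solve 2 (λ u v →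
      ((u :* con 1 :+ v :* con 1) :* con 1) :* con 1 :=
      con 1 :* ((con 1 :* con 1) :* ((u :+ v) :* con 1))) ℤ[V].refl (X u) (ℤ[V].- X v)))
    where g′ = frac ℤ[V].1# (∏-diff [ (u , v) ]) (∏-diff-regular (u≢v ∷ []))

  open ShuffleIdentity ℚ⟨V⟩ x g g-inverse using (G; ∑-cong; ∏-resp-↭; ∑-cyclic-shuffles)

  -- The convention that a degenerate product has value 0 is itself multiplicative: a vanishing
  -- factor makes both sides 0. Hence `1/∏-diff` agrees with `G` on every list.
  1/∏-diff-∷ : ∀ p ps → 1/∏-diff (p ∷ ps) ≈ uncurry g p * 1/∏-diff ps
  1/∏-diff-∷ p@(u , v) ps = cases (u ≟ v) (all? (λ (u , v) → ¬? (u ≟ v)) ps)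
    where
    cases : Dec (u ≡ v) → Dec (All (uncurry _≢_) ps) →
      1/∏-diff (p ∷ ps) ≈ g u v * 1/∏-diff ps
    cases (yes u≡v) _ = trans {1/∏-diff (p ∷ ps)} {0#} {g u v * 1/∏-diff ps}
      (1/∏-diff-degenerate λ { (u≢v ∷ _) → u≢v u≡v })
      (sym {g u v * 1/∏-diff ps} {0#} (trans {g u v * 1/∏-diff ps} {0# * 1/∏-diff ps} {0#}
        (*-congʳ {1/∏-diff ps} {g u v} {0#} (1/∏-diff-degenerate λ { (u≢v ∷ []) → u≢v u≡v }))
        (zeroˡ (1/∏-diff ps))))
    cases (no _) (no ¬dis) = trans {1/∏-diff (p ∷ ps)} {0#} {g u v * 1/∏-diff ps}
      (1/∏-diff-degenerate λ { (_ ∷ dis) → ¬dis dis })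
      (sym {g u v * 1/∏-diff ps} {0#} (trans {g u v * 1/∏-diff ps} {g u v * 0#} {0#}
        (*-congˡ {g u v} {1/∏-diff ps} {0#} (1/∏-diff-degenerate ¬dis))
        (zeroʳ (g u v))))
    cases (no u≢v) (yes dis) = trans
      {1/∏-diff (p ∷ ps)} {frac ℤ[V].1# (∏-diff (p ∷ ps)) r} {g u v * 1/∏-diff ps}
      (1/∏-diff-distinct (u≢v ∷ dis))
      (trans {frac ℤ[V].1# (∏-diff (p ∷ ps)) r} {g′ * h′} {g u v * 1/∏-diff ps}
        (eq (solve 2 (λ d q → con 1 :* ((d :* con 1) :* q) := (con 1 :* con 1) :* (d :* q))
          ℤ[V].refl (X u ℤ[V].- X v) (∏-diff ps)))
        (*-cong {g′} {g u v} {h′} {1/∏-diff ps}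
          (sym {g u v} {g′} (1/∏-diff-distinct (u≢v ∷ [])))
          (sym {1/∏-diff ps} {h′} (1/∏-diff-distinct dis))))
      where
      r = ∏-diff-regular (u≢v ∷ dis)
      g′ = frac ℤ[V].1# (∏-diff [ p ]) (∏-diff-regular (u≢v ∷ []))
      h′ = frac ℤ[V].1# (∏-diff ps) (∏-diff-regular dis)

  1/∏-diff≈G : ∀ ps → 1/∏-diff ps ≈ G ps
  1/∏-diff≈G []       = 1/∏-diff-distinct []
  1/∏-diff≈G (p ∷ ps) = trans {1/∏-diff (p ∷ ps)} {uncurry g p * 1/∏-diff ps} {G (p ∷ ps)}
    (1/∏-diff-∷ p ps) (*-congˡ {uncurry g p} {1/∏-diff ps} {G ps} (1/∏-diff≈G ps))

  1/∏-diff-resp-↭ : ∀ {ps qs} → ps ↭ qs → 1/∏-diff ps ≈ 1/∏-diff qs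
  1/∏-diff-resp-↭ {ps} {qs} p = trans {1/∏-diff ps} {G ps} {1/∏-diff qs} (1/∏-diff≈G ps)
    (trans {G ps} {G qs} {1/∏-diff qs} (∏-resp-↭ (uncurry g) p)
      (sym {1/∏-diff qs} {G qs} (1/∏-diff≈G qs)))

  ∑-Ψ-shuffles : ∀ {k} e z bs cs → length bs ≡ k → Unique (e ∷ z ∷ bs ++ cs) →
    ∑ (shuffles bs cs) (λ as → Ψ (e ∷ z ∷ as)) ≈
    -1^ k * 1/∏-diff (map swap (steps (z ∷ bs ++ [ e ])) ++ steps (z ∷ cs ++ [ e ]))
  ∑-Ψ-shuffles e z bs cs ≡.refl u = trans {s₀} {s₁} {s₃}
    (∑-cong (shuffles bs cs) (λ as → 1/∏-diff≈G (cyclicSteps (e ∷ z ∷ as))))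
    (trans {s₁} {s₂} {s₃} (∑-cyclic-shuffles e z bs cs u)
      (*-congˡ { -1^ (length bs)} {G ps} {1/∏-diff ps} (sym {1/∏-diff ps} {G ps} (1/∏-diff≈G ps))))
    where
    ps = map swap (steps (z ∷ bs ++ [ e ])) ++ steps (z ∷ cs ++ [ e ])
    s₀ s₁ s₂ s₃ : Carrier
    s₀ = ∑ (shuffles bs cs) (λ as → Ψ (e ∷ z ∷ as))
    s₁ = ∑ (shuffles bs cs) (λ as → G (cyclicSteps (e ∷ z ∷ as)))
    s₂ = -1^ (length bs) * G ps
    s₃ = -1^ (length bs) * 1/∏-diff ps

  -- Cutting the cyclic word at `z` leaves two paths: from `e` backwards through `bs` to `z`, and
  -- from `z` through `cs` to `e`. This links the closed formula with its equivalent form.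
  Ψ-rev : ∀ e z bs cs →
    Ψ (e ∷ reverse bs ++ z ∷ cs) ≈
    1/∏-diff (map swap (steps (z ∷ bs ++ [ e ])) ++ steps (z ∷ cs ++ [ e ]))
  Ψ-rev e z bs cs = 1/∏-diff-resp-↭ (↭-trans (↭-reflexive split)
    (↭.++⁺ʳ (steps (z ∷ cs ++ [ e ])) (steps-reverse (z ∷ bs ++ [ e ]))))
    where
    open ≡.≡-Reasoning
    path-reverse : e ∷ reverse bs ++ [ z ] ≡ reverse (z ∷ bs ++ [ e ])
    path-reverse = begin
      e ∷ reverse bs ++ [ z ]         ≡⟨ ≡.cong (e ∷_) (List.unfold-reverse z bs) ⟨
      e ∷ reverse (z ∷ bs)            ≡⟨ List.reverse-++ (z ∷ bs) [ e ] ⟨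
      reverse (z ∷ bs ++ [ e ])       ∎
    split : cyclicSteps (e ∷ reverse bs ++ z ∷ cs) ≡
      steps (reverse (z ∷ bs ++ [ e ])) ++ steps (z ∷ cs ++ [ e ])
    split = begin
      steps (e ∷ (reverse bs ++ z ∷ cs) ++ [ e ])
        ≡⟨ ≡.cong (steps ∘ (e ∷_)) (List.++-assoc (reverse bs) (z ∷ cs) [ e ]) ⟩
      steps (e ∷ reverse bs ++ z ∷ cs ++ [ e ])
        ≡⟨ steps-++ (e ∷ reverse bs) z (cs ++ [ e ]) ⟩
      steps (e ∷ reverse bs ++ [ z ]) ++ steps (z ∷ cs ++ [ e ])
        ≡⟨ ≡.cong (λ l → steps l ++ steps (z ∷ cs ++ [ e ])) path-reverse ⟩
      steps (reverse (z ∷ bs ++ [ e ])) ++ steps (z ∷ cs ++ [ e ])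
        ∎

  Ψ-rotate : ∀ w → Ψ (rotate w) ≈ Ψ w
  Ψ-rotate w = 1/∏-diff-resp-↭ (cyclicSteps-rotate w)

  Ψ-≈rot : ∀ {w w′} → w ≈rot w′ → Ψ w ≈ Ψ w′
  Ψ-≈rot Star.ε = eq ℤ[V].refl
  Ψ-≈rot {w} {w′} (Star._◅_ ≡.refl r) = trans {Ψ w} {Ψ (rotate w)} {Ψ w′}
    (sym {Ψ (rotate w)} {Ψ w} (Ψ-rotate w)) (Ψ-≈rot r)

-- Dedekind reals modulo ℤ

-- The detour through unnormalised rationals avoids reduction to lowest terms; there the claim is
-- integer arithmetic over the denominator 1.
/1-homo-+ : ∀ m n → (m ℤ.+ n) / 1 ≡ m / 1 ℚ.+ n / 1
/1-homo-+ m n = ℚ.toℚᵘ-injective (begin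
  ℚ.toℚᵘ ((m ℤ.+ n) / 1)                 ≈⟨ ℚ.toℚᵘ-fromℚᵘ (mkℚᵘ (m ℤ.+ n) 0) ⟩
  mkℚᵘ (m ℤ.+ n) 0                       ≈⟨ *≡* (≡.cong (ℤ._* ℤ.1ℤ)
                                                (≡.cong₂ ℤ._+_ (ℤ.*-identityʳ m) (ℤ.*-identityʳ n))) ⟨
  mkℚᵘ m 0 ℚᵘ.+ mkℚᵘ n 0                 ≈⟨ ℚᵘ.+-cong (ℚ.toℚᵘ-fromℚᵘ (mkℚᵘ m 0))
                                                      (ℚ.toℚᵘ-fromℚᵘ (mkℚᵘ n 0)) ⟨
  ℚ.toℚᵘ (m / 1) ℚᵘ.+ ℚ.toℚᵘ (n / 1)     ≈⟨ ℚ.toℚᵘ-homo-+ (m / 1) (n / 1) ⟨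
  ℚ.toℚᵘ (m / 1 ℚ.+ n / 1)               ∎)
  where open import Relation.Binary.Reasoning.Setoid ℚᵘ.≃-setoid

+-/1-cancel : ∀ q m → (q ℚ.+ (ℤ.- m) / 1) ℚ.+ m / 1 ≡ q
+-/1-cancel q m = begin
  (q ℚ.+ (ℤ.- m) / 1) ℚ.+ m / 1    ≡⟨ ℚ.+-assoc q _ _ ⟩
  q ℚ.+ ((ℤ.- m) / 1 ℚ.+ m / 1)    ≡⟨ ≡.cong (q ℚ.+_) (/1-homo-+ (ℤ.- m) m) ⟨
  q ℚ.+ (ℤ.- m ℤ.+ m) / 1          ≡⟨ ≡.cong (λ n → q ℚ.+ n / 1) (ℤ.+-inverseˡ m) ⟩
  q ℚ.+ 0ℚ                         ≡⟨ ℚ.+-identityʳ q ⟩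
  q                                ∎
  where open ≡.≡-Reasoning

≃ᴿ-sym : ∀ {x y} → x ≃ᴿ y → y ≃ᴿ x
≃ᴿ-sym x≃y q = ⇔-sym (proj₁ (x≃y q)) , ⇔-sym (proj₂ (x≃y q))

≃ᴿ⇒∼ℤ : ∀ {x y} → x ≃ᴿ y → x ∼ℤ y
≃ᴿ⇒∼ℤ {x} {y} x≃y = +0 , λ q →
  ≡.subst (λ r → (L x q ⇔ L y r) × (U x q ⇔ U y r)) (≡.sym (ℚ.+-identityʳ q)) (x≃y q)

∼ℤ-refl : ∀ {x} → x ∼ℤ x
∼ℤ-refl {x} = ≃ᴿ⇒∼ℤ {x} {x} λ q → mk⇔ id id , mk⇔ id id

∼ℤ-sym : ∀ {x y} → x ∼ℤ y → y ∼ℤ x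
∼ℤ-sym {x} {y} (m , f) = ℤ.- m , λ q →
  ≡.subst (λ r → (L y r ⇔ L x (q ℚ.+ (ℤ.- m) / 1)) × (U y r ⇔ U x (q ℚ.+ (ℤ.- m) / 1)))
    (+-/1-cancel q m)
    (⇔-sym (proj₁ (f (q ℚ.+ (ℤ.- m) / 1))) , ⇔-sym (proj₂ (f (q ℚ.+ (ℤ.- m) / 1))))

∼ℤ-trans : ∀ {x y z} → x ∼ℤ y → y ∼ℤ z → x ∼ℤ z
∼ℤ-trans {x} {y} {z} (m , f) (n , g) = m ℤ.+ n , λ q →
  ≡.subst (λ r → (L x q ⇔ L z r) × (U x q ⇔ U z r))
    (≡.trans (ℚ.+-assoc q (m / 1) (n / 1)) (≡.cong (q ℚ.+_) (≡.sym (/1-homo-+ m n))))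
    (⇔-trans (proj₁ (f q)) (proj₁ (g (q ℚ.+ m / 1))) ,
     ⇔-trans (proj₂ (f q)) (proj₂ (g (q ℚ.+ m / 1))))

<ᴿ-irrefl : ∀ {x y} → x ≃ᴿ y → ¬ (x <ᴿ y)
<ᴿ-irrefl {x} x≃y (q , Ux , Ly) = disjoint x q (from (proj₁ (x≃y q)) Ly , Ux)

<ᴿ-resp-≃ᴿ : ∀ {x x′ y y′} → x ≃ᴿ x′ → y ≃ᴿ y′ → x <ᴿ y → x′ <ᴿ y′
<ᴿ-resp-≃ᴿ x≃x′ y≃y′ (q , Ux , Ly) = q , to (proj₂ (x≃x′ q)) Ux , to (proj₁ (y≃y′ q)) Ly

L⇒<U : ∀ x {q r} → L x q → U x r → q ℚ.< r
L⇒<U x {q} {r} Lq Ur with ℚ.<-cmp q r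
... | tri< q<r _ _    = q<r
... | tri≈ _ ≡.refl _ = contradiction (Lq , Ur) (disjoint x q)
... | tri> _ _ r<q    = contradiction (from (L-rounded x r) (q , r<q , Lq) , Ur) (disjoint x r)

<ᴿ-asym : ∀ {x y} → x <ᴿ y → ¬ (y <ᴿ x)
<ᴿ-asym {x} {y} (q , Uxq , Lyq) (r , Uyr , Lxr) = ℚ.<-asym (L⇒<U y Lyq Uyr) (L⇒<U x Lxr Uxq)

fromℚ-mono-< : ∀ {p q} → p ℚ.< q → fromℚ p <ᴿ fromℚ q
fromℚ-mono-< = ℚ.<-dense

fromℚ-mono-≤ : ∀ {p q} → p ℚ.≤ q → fromℚ p ≤ᴿ fromℚ q
fromℚ-mono-≤ p≤q (r , q<r , r<p) = ℚ.<-irrefl ≡.refl (ℚ.<-≤-trans (ℚ.<-trans q<r r<p) p≤q)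

InUnit : ℝ → Set
InUnit x = (fromℚ 0ℚ ≤ᴿ x) × (x <ᴿ fromℚ 1ℚ)

1≤+suc/1 : ∀ n → 1ℚ ℚ.≤ +[1+ n ] / 1
1≤+suc/1 n = ≡.subst (1ℚ ℚ.≤_) (≡.sym (/1-homo-+ (ℤ.+ 1) (ℤ.+ n)))
  (≡.subst (ℚ._≤ 1ℚ ℚ.+ (ℤ.+ n) / 1) (ℚ.+-identityʳ 1ℚ)
    (ℚ.+-monoʳ-≤ 1ℚ (ℚ.nonNegative⁻¹ ((ℤ.+ n) / 1) {{ℚ.normalize-nonNeg n 1}})))

-- If `y` were `x` plus a positive integer, a rational upper bound of `y` below 1 would shift to a
-- negative upper bound of `x`.
no-positive-shift : ∀ {x y} n → InUnit x → InUnit y →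
  ¬ (∀ q → (L x q ⇔ L y (q ℚ.+ +[1+ n ] / 1)) × (U x q ⇔ U y (q ℚ.+ +[1+ n ] / 1)))
no-positive-shift {x} {y} n (0≤x , _) (_ , q , Uyq , q<1) f = 0≤x (r , Uxr , r<0)
  where
  m = +[1+ n ]
  r = q ℚ.+ (ℤ.- m) / 1
  Uxr : U x r
  Uxr = from (proj₂ (f r)) (≡.subst (U y) (≡.sym (+-/1-cancel q m)) Uyq)
  r<0 : r ℚ.< 0ℚ
  r<0 = ≡.subst (r ℚ.<_) (ℚ.+-inverseʳ (m / 1))
    (ℚ.+-monoˡ-< ((ℤ.- m) / 1) (ℚ.<-≤-trans q<1 (1≤+suc/1 n)))

-- `Chamber` and `OrderChamber` hide their representatives in an existential; this pins them down up
-- to `≃ᴿ`. A negative shift is a positive one with the two numbers exchanged.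
InUnit-unique : ∀ {x y} → InUnit x → InUnit y → x ∼ℤ y → x ≃ᴿ y
InUnit-unique {x} {y} ux uy (+0 , f) = λ q →
  ≡.subst (λ r → (L x q ⇔ L y r) × (U x q ⇔ U y r)) (ℚ.+-identityʳ q) (f q)
InUnit-unique {x} {y} ux uy (+[1+ n ] , f) = contradiction f (no-positive-shift {x} {y} n ux uy)
InUnit-unique {x} {y} ux uy x∼y@(-[1+ n ] , _) =
  contradiction (proj₂ (∼ℤ-sym {x} {y} x∼y)) (no-positive-shift {y} {x} n uy ux)

-- Any strictly increasing sequence in [0,1) serves; density of ℚ spares its arithmetic.
ladder : ℕ → ∃ λ q → q ℚ.< 1ℚ
ladder zero    = 0ℚ , ℚ.positive⁻¹ 1ℚ
ladder (suc n) = let _ , q<1 = ladder n ; r , _ , r<1 = ℚ.<-dense q<1 in r , r<1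

rung : ℕ → ℚ
rung n = proj₁ (ladder n)

rung-suc : ∀ n → rung n ℚ.< rung (suc n)
rung-suc n = proj₁ (proj₂ (ℚ.<-dense (proj₂ (ladder n))))

rung-mono-≤ : ∀ {m n} → m ℕ.≤′ n → rung m ℚ.≤ rung n
rung-mono-≤ (ℕ.≤′-reflexive ≡.refl) = ℚ.≤-refl
rung-mono-≤ (ℕ.≤′-step {n} m≤n)     = ℚ.≤-trans (rung-mono-≤ m≤n) (ℚ.<⇒≤ (rung-suc n))

rung-mono-< : ∀ {m n} → m < n → rung m ℚ.< rung n
rung-mono-< {m} {n} m<n = ℚ.<-≤-trans (rung-suc m) (rung-mono-≤ {suc m} {n} (ℕ.≤⇒≤′ m<n))

rung-InUnit : ∀ n → InUnit (fromℚ (rung n))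
rung-InUnit n = fromℚ-mono-≤ (rung-mono-≤ {0} {n} (ℕ.≤⇒≤′ z≤n)) , fromℚ-mono-< (proj₂ (ladder n))

rung-cancel-< : ∀ {m n} → fromℚ (rung m) <ᴿ fromℚ (rung n) → m < n
rung-cancel-< {m} {n} (q , rm<q , q<rn) with ℕ.<-cmp m n
... | tri< m<n _ _    = m<n
... | tri≈ _ ≡.refl _ = contradiction (ℚ.<-trans rm<q q<rn) (ℚ.<-irrefl ≡.refl)
... | tri> _ _ n<m    = contradiction (ℚ.<-trans rm<q q<rn) (ℚ.<-asym (rung-mono-< n<m))

-- Rotations

-- In `go`, `p` collects the letters already moved to the back and `q` those still ahead. When `q`
-- runs out, a full turn is complete and the collected letters are turned again, so any number of
-- rotations comes down to one cut.
≈rot-split : {w w′ : List V} → w ≈rot w′ → ∃₂ λ p q → w ≡ p ++ q × w′ ≡ q ++ p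
≈rot-split r = go [] _ (≡.sym (List.++-identityʳ _)) r
  where
  go : {w w′ : List V} → ∀ p q → w ≡ q ++ p → w ≈rot w′ →
    ∃₂ λ p′ q′ → p ++ q ≡ p′ ++ q′ × w′ ≡ q′ ++ p′
  go p       q       w≡ Star.ε               = p , q , ≡.refl , w≡
  go p       (x ∷ q) ≡.refl (≡.refl ◅ r)
    with p′ , q′ , e , e′ ← go (p ++ [ x ]) q (List.++-assoc q p [ x ]) r =
    p′ , q′ , ≡.trans (≡.sym (List.++-assoc p [ x ] q)) e , e′
  go []      []      ≡.refl (≡.refl ◅ r) = go [] [] ≡.refl r
  go (x ∷ p) []      ≡.refl (≡.refl ◅ r)
    with p′ , q′ , e , e′ ← go [ x ] p ≡.refl r =
    p′ , q′ , ≡.trans (≡.cong (x ∷_) (List.++-identityʳ p)) e , e′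

++-≈rot : (p q : List V) → (p ++ q) ≈rot (q ++ p)
++-≈rot []      q = ≡.subst (q ≈rot_) (≡.sym (List.++-identityʳ q)) Star.ε
++-≈rot (x ∷ p) q = ≡.sym (List.++-assoc p q [ x ]) ◅
  ≡.subst (λ r → (p ++ q ++ [ x ]) ≈rot r) (List.++-assoc q [ x ] p) (++-≈rot p (q ++ [ x ]))

≈rot-sym : {w w′ : List V} → w ≈rot w′ → w′ ≈rot w
≈rot-sym r with p , q , ≡.refl , ≡.refl ← ≈rot-split r = ++-≈rot q p

≈rot⇒↭ : {w w′ : List V} → w ≈rot w′ → w ↭ w′
≈rot⇒↭ r with p , q , ≡.refl , ≡.refl ← ≈rot-split r = ↭.++-comm p q

≈rot-permutation : {w w′ : List V} → w ≈rot w′ → IsPermutation w → IsPermutation w′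
≈rot-permutation r (u , full) =
  AllPairs-resp-↭ (_∘ ≡.sym) (≈rot⇒↭ r) u , λ v → ↭.∈-resp-↭ (≈rot⇒↭ r) (full v)

-- A proper rotation starting with the same letter would show that letter a second time inside the
-- word.
≈rot-head : ∀ {x : V} {as as′} → Unique (x ∷ as) → (x ∷ as) ≈rot (x ∷ as′) → as ≡ as′
≈rot-head {x = x} u r with ≈rot-split r
... | []    , _     , ≡.refl , e = List.∷-injectiveʳ (≡.sym (≡.trans e (List.++-identityʳ _)))
... | _ ∷ p , []    , ≡.refl , ≡.refl = List.++-identityʳ p
... | _ ∷ p , _ ∷ _ , ≡.refl , ≡.refl =
  contradiction (∈-++⁺ʳ p (here ≡.refl)) (Unique.Unique[x∷xs]⇒x∉xs u)

rotate-to : ∀ {x : V} {w} → x ∈ w → ∃ λ as → w ≈rot (x ∷ as)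
rotate-to {x = x} x∈w with p , q , ≡.refl ← ∈-∃++ x∈w = q ++ p , ++-≈rot p (x ∷ q)

-- Positions

module Positions (_≟_ : DecidableEquality V) where

  pos : List V → V → ℕ
  pos []      v = 0
  pos (x ∷ w) v with v ≟ x
  ... | yes _ = 0
  ... | no  _ = suc (pos w v)

  pos-here : ∀ x w → pos (x ∷ w) x ≡ 0
  pos-here x w with x ≟ x
  ... | yes _  = ≡.refl
  ... | no x≢x = contradiction ≡.refl x≢x

  pos-there : ∀ {x v} w → v ≢ x → pos (x ∷ w) v ≡ suc (pos w v)
  pos-there {x} {v} w v≢x with v ≟ x
  ... | yes v≡x = contradiction v≡x v≢x
  ... | no  _   = ≡.refl

  ∈-tail : ∀ {x v : V} {w} → v ≢ x → v ∈ x ∷ w → v ∈ w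
  ∈-tail v≢x (here v≡x) = contradiction v≡x v≢x
  ∈-tail v≢x (there v∈w) = v∈w

  pos-injective : ∀ {u v w} → u ∈ w → v ∈ w → pos w u ≡ pos w v → u ≡ v
  pos-injective {u} {v} {x ∷ w} u∈ v∈ e with u ≟ x | v ≟ x
  ... | yes u≡x | yes v≡x = ≡.trans u≡x (≡.sym v≡x)
  ... | no  u≢x | no  v≢x = pos-injective (∈-tail u≢x u∈) (∈-tail v≢x v∈) (ℕ.suc-injective e)

  pos-increasing : ∀ {w} → Unique w → AllPairs (λ u v → pos w u < pos w v) w
  pos-increasing []            = []
  pos-increasing {x ∷ w} (x∉ ∷ uniq) =
    All.map (λ x≢v → ≡.subst₂ _<_ (≡.sym (pos-here x w))
      (≡.sym (pos-there w (x≢v ∘ ≡.sym))) ℕ.z<s) x∉ ∷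
    tail x∉ (pos-increasing uniq)
    where
    tail : ∀ {l} → All (x ≢_) l → AllPairs (λ u v → pos w u < pos w v) l →
      AllPairs (λ u v → pos (x ∷ w) u < pos (x ∷ w) v) l
    tail []       []       = []
    tail (n ∷ ns) (r ∷ rs) = All.zipWith (λ (n′ , u<v) →
        ≡.subst₂ _<_ (≡.sym (pos-there w (n ∘ ≡.sym))) (≡.sym (pos-there w (n′ ∘ ≡.sym))) (s≤s u<v))
      (ns , r) ∷ tail ns rs

  -- An absent letter gets the length of the word as its position, so lying before `v ∈ w` already
  -- forces `u` to occur.
  pos-AllPairs : ∀ {ℓ} {R : Rel V ℓ} {u v w} → AllPairs R w → v ∈ w → pos w u < pos w v → R u v
  pos-AllPairs {u = u} {v} {x ∷ w} (r ∷ rs) v∈ lt with u ≟ x | v ≟ x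
  ... | yes ≡.refl | no v≢x = All.lookup r (∈-tail v≢x v∈)
  ... | no  _      | no v≢x = pos-AllPairs rs (∈-tail v≢x v∈) (ℕ.s<s⁻¹ lt)

  -- Greedy matching: each entry of `w` is used if it is the next one wanted and skipped otherwise.
  -- This turns orientations along paths into the embeddings that `IsShuffle` asks for.
  pos-⊆ : ∀ {l w} → All (_∈ w) l → AllPairs (λ u v → pos w u < pos w v) l → l ⊆ w
  pos-⊆ {[]}    {w}     _ _ = minimum w
  pos-⊆ {y ∷ l} {x ∷ w} (y∈ ∷ l∈) (y< ∷ l<) = cases (y ≟ x)
    where
    -- Entries after `y` have positive position, whereas the head `x` has position 0.
    behind : All (_≢ x) l
    behind = All.map (λ {v} lt v≡x → ℕ.n≮0 (≡.subst (pos (x ∷ w) y <_)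
      (≡.trans (≡.cong (pos (x ∷ w)) v≡x) (pos-here x w)) lt)) y<
    shift : ∀ {m} → All (_≢ x) m → AllPairs (λ u v → pos (x ∷ w) u < pos (x ∷ w) v) m →
      AllPairs (λ u v → pos w u < pos w v) m
    shift []       []       = []
    shift (n ∷ ns) (r ∷ rs) = All.zipWith (λ (n′ , lt) →
      ℕ.s<s⁻¹ (≡.subst₂ _<_ (pos-there w n) (pos-there w n′) lt)) (ns , r) ∷ shift ns rs
    l∈w : All (_∈ w) l
    l∈w = All.zipWith (λ (n , v∈) → ∈-tail n v∈) (behind , l∈)
    cases : Dec (y ≡ x) → y ∷ l ⊆ x ∷ w
    cases (yes y≡x) = y≡x ∷ pos-⊆ l∈w (shift behind l<)
    cases (no  y≢x) = x ∷ʳ pos-⊆ (∈-tail y≢x y∈ ∷ l∈w) (shift (y≢x ∷ behind) (y< ∷ l<))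

  pos-∷ʳ : ∀ {v} w x → v ∈ w → pos (w ++ [ x ]) v ≡ pos w v
  pos-∷ʳ {v} (y ∷ w) x v∈ with v ≟ y
  ... | yes _  = ≡.refl
  ... | no v≢y = ≡.cong suc (pos-∷ʳ w x (∈-tail v≢y v∈))

  pos-last : ∀ {v} w x → x ∉ w → v ∈ w → pos (w ++ [ x ]) v < pos (w ++ [ x ]) x
  pos-last {v} (y ∷ w) x x∉ v∈ with v ≟ y | x ≟ y
  ... | _      | yes x≡y = contradiction (here x≡y) x∉
  ... | yes _  | no  _   = ℕ.z<s
  ... | no v≢y | no  _   = s≤s (pos-last w x (x∉ ∘ there) (∈-tail v≢y v∈))

-- Orientations by words

T-ext : ∀ {x y} → (T x → T y) → (T y → T x) → x ≡ y
T-ext {true}  {true}  _ _ = ≡.refl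
T-ext {true}  {false} f _ = contradiction _ f
T-ext {false} {true}  _ g = contradiction _ g
T-ext {false} {false} _ _ = ≡.refl

module Orientation (_≟_ : DecidableEquality V) where
  open Positions _≟_
  open Quiver using (arc; acyclic; Edge; IsSink)

  Edge-irrefl : ∀ (Q : Quiver V) {u v} → Edge Q u v → u ≢ v
  Edge-irrefl Q (inj₁ uv) ≡.refl = acyclic Q _ [ uv ]⁺
  Edge-irrefl Q (inj₂ vu) ≡.refl = acyclic Q _ [ vu ]⁺

  module _ (Q : Quiver V) (w : List V) where

    oriented : V → V → Bool
    oriented u v = (arc Q u v ∨ arc Q v u) ∧ (pos w u <ᵇ pos w v)

    T-oriented : ∀ {u v} → T (oriented u v) ⇔ (Edge Q u v × pos w u < pos w v)
    T-oriented {u} {v} = mk⇔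
      (λ t → let e , lt = to Bool.T-∧ t in to Bool.T-∨ e , ℕ.<ᵇ⇒< _ _ lt)
      (λ (e , lt) → from (Bool.T-∧ {arc Q u v ∨ arc Q v u}) (from Bool.T-∨ e , ℕ.<⇒<ᵇ lt))

    walk-forward : ∀ {u v} → TransClosure (λ u v → T (oriented u v)) u v → pos w u < pos w v
    walk-forward [ uv ]⁺  = proj₂ (to T-oriented uv)
    walk-forward (uv ∷⁺ p) = ℕ.<-trans (proj₂ (to T-oriented uv)) (walk-forward p)

    orient : Quiver V
    orient = record { arc = oriented ; acyclic = λ v p → ℕ.<-irrefl ≡.refl (walk-forward p) }

  -- The first letter of a word is a source of the induced orientation. At the end of the word it is
  -- a sink, while the other letters keep their relative order, so only the arcs at `x` change.
  flip-head : ∀ (Q : Quiver V) x w → IsPermutation (x ∷ w) →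
    Flip (orient Q (x ∷ w)) (orient Q (w ++ [ x ]))
  flip-head Q x w (uniq , full) = record
    { vertex         = x
    ; source-or-sink = inj₁ λ u ux → ℕ.n≮0
        (≡.subst (pos (x ∷ w) u <_) (pos-here x w) (proj₂ (to (T-oriented Q (x ∷ w)) ux)))
    ; reversed       = λ { u v (inj₁ ≡.refl) → T-ext (out v) (into v)
                         ; u v (inj₂ ≡.refl) → T-ext (back u) (forth u) }
    ; unchanged      = λ u v u≢x v≢x → T-ext
        (λ t → let e , lt = to (T-oriented Q (w ++ [ x ])) t in from (T-oriented Q (x ∷ w))
          (e , ≡.subst₂ _<_ (≡.sym (same u≢x)) (≡.sym (same v≢x)) (s≤s lt)))
        (λ t → let e , lt = to (T-oriented Q (x ∷ w)) t in from (T-oriented Q (w ++ [ x ]))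
          (e , ℕ.s<s⁻¹ (≡.subst₂ _<_ (same u≢x) (same v≢x) lt)))
    }
    where
    x∉w : x ∉ w
    x∉w = Unique.Unique[x∷xs]⇒x∉xs uniq
    ∈w : ∀ {v} → v ≢ x → v ∈ w
    ∈w {v} v≢x = ∈-tail v≢x (full v)
    same : ∀ {v} → v ≢ x → pos (x ∷ w) v ≡ suc (pos (w ++ [ x ]) v)
    same v≢x = ≡.trans (pos-there w v≢x) (≡.cong suc (≡.sym (pos-∷ʳ w x (∈w v≢x))))
    first : ∀ {v} → v ≢ x → pos (x ∷ w) x < pos (x ∷ w) v
    first v≢x = ≡.subst₂ _<_ (≡.sym (pos-here x w)) (≡.sym (pos-there w v≢x)) ℕ.z<s
    last : ∀ {v} → v ≢ x → pos (w ++ [ x ]) v < pos (w ++ [ x ]) x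
    last v≢x = pos-last w x x∉w (∈w v≢x)
    back : ∀ u → T (oriented Q (w ++ [ x ]) u x) → T (oriented Q (x ∷ w) x u)
    back u t = let e , _ = to (T-oriented Q (w ++ [ x ])) t in
      from (T-oriented Q (x ∷ w)) (Sum.swap e , first (Edge-irrefl Q e))
    forth : ∀ u → T (oriented Q (x ∷ w) x u) → T (oriented Q (w ++ [ x ]) u x)
    forth u t = let e , _ = to (T-oriented Q (x ∷ w)) t in
      from (T-oriented Q (w ++ [ x ])) (Sum.swap e , last (Edge-irrefl Q (Sum.swap e)))
    out : ∀ v → T (oriented Q (w ++ [ x ]) x v) → T (oriented Q (x ∷ w) v x)
    out v t = let e , lt = to (T-oriented Q (w ++ [ x ])) t in
      contradiction lt (ℕ.<-asym (last (Edge-irrefl Q (Sum.swap e))))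
    into : ∀ v → T (oriented Q (x ∷ w) v x) → T (oriented Q (w ++ [ x ]) x v)
    into v t = let e , lt = to (T-oriented Q (x ∷ w)) t in
      contradiction lt (ℕ.<-asym (first (Edge-irrefl Q e)))

  orient-≈rot : ∀ (Q : Quiver V) {w w′} → IsPermutation w → w ≈rot w′ → orient Q w ≈flip orient Q w′
  orient-≈rot Q           perm Star.ε            = Star.ε
  orient-≈rot Q {[]}      perm (≡.refl ◅ r) = orient-≈rot Q perm r
  orient-≈rot Q {x ∷ w} perm (≡.refl ◅ r) =
    flip-head Q x w perm ◅ orient-≈rot Q (≈rot-permutation {w = x ∷ w} (≡.refl ◅ Star.ε) perm) r

  -- This flip leads from a given quiver to an orientation read off a word: the arcs at the sink `e`
  -- turn around when `e` is put first, and all others already point forward.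
  flip-sink : ∀ (Q : Quiver V) e w → IsSink Q e →
    (∀ {u v} → T (arc Q u v) → v ≢ e → pos (e ∷ w) u < pos (e ∷ w) v) →
    Flip Q (orient Q (e ∷ w))
  flip-sink Q e w sink increasing = record
    { vertex         = e
    ; source-or-sink = inj₂ sink
    ; reversed       = λ { u v (inj₁ ≡.refl) → T-ext
          (λ t → [ (λ ev → contradiction ev (sink v)) , id ]′ (proj₁ (to (T-oriented Q (e ∷ w)) t)))
          (λ ve → from (T-oriented Q (e ∷ w)) (inj₂ ve , first (Edge-irrefl Q (inj₁ ve))))
                         ; u v (inj₂ ≡.refl) → T-ext
          (λ t → contradiction (proj₂ (to (T-oriented Q (e ∷ w)) t))
            (≡.subst (λ n → ¬ (pos (e ∷ w) u < n)) (≡.sym (pos-here e w)) ℕ.n≮0))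
          (λ eu → contradiction eu (sink u)) }
    ; unchanged      = λ u v u≢e v≢e → T-ext
        (λ t → let ed , lt = to (T-oriented Q (e ∷ w)) t in
          [ id , (λ vu → contradiction lt (ℕ.<-asym (increasing vu u≢e))) ]′ ed)
        (λ uv → from (T-oriented Q (e ∷ w)) (inj₁ uv , increasing uv v≢e))
    }
    where
    first : ∀ {v} → v ≢ e → pos (e ∷ w) e < pos (e ∷ w) v
    first v≢e = ≡.subst₂ _<_ (≡.sym (pos-here e w)) (≡.sym (pos-there w v≢e)) ℕ.z<s

  -- At a point of the order chamber the coordinates in [0,1) are sorted by a rotation `w′` of `w`,
  -- so the orientation there is `orient Q w′`, reached by the flips that realise the rotation. On
  -- the arrangement two adjacent coordinates would coincide, against the strict order.
  orient-toric : ∀ (Q : Quiver V) w → IsPermutation w → Q ≈flip orient Q w → IsToricExtension Q w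
  orient-toric Q w perm flips = perm , chamber
    where
    chamber : ∀ x → OrderChamber w x → Chamber Q x
    chamber x (y , y≡x , w′ , r , ordered) =
      (λ (u , v , uv , x′ , x∼x′ , x′u≃x′v) → apart uv (InUnit-unique {y u} {y v} (unit u) (unit v)
        (∼ℤ-trans {y u} {x′ u} {y v}
          (∼ℤ-trans {y u} {x u} {x′ u} (∼ℤ-sym {x u} {y u} (proj₂ (proj₂ (y≡x u)))) (x∼x′ u))
          (∼ℤ-trans {x′ u} {x′ v} {y v} (≃ᴿ⇒∼ℤ {x′ u} {x′ v} x′u≃x′v)
            (∼ℤ-trans {x′ v} {x v} {y v} (∼ℤ-sym {x v} {x′ v} (x∼x′ v)) (proj₂ (proj₂ (y≡x v)))))))) ,
      y , y≡x , orient Q w′ , flips ◅◅ orient-≈rot Q perm r , λ u v → mk⇔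
        (λ t → let e , lt = to (T-oriented Q w′) t in e , forward lt)
        (λ (e , lt) → from (T-oriented Q w′) (e , backward e lt))
      where
      full′ : ∀ v → v ∈ w′
      full′ = proj₂ (≈rot-permutation r perm)
      unit : ∀ v → InUnit (y v)
      unit v = proj₁ (y≡x v) , proj₁ (proj₂ (y≡x v))
      forward : ∀ {u v} → pos w′ u < pos w′ v → y u <ᴿ y v
      forward {v = v} = pos-AllPairs ordered (full′ v)
      apart : ∀ {u v} → Edge Q u v → ¬ (y u ≃ᴿ y v)
      apart {u} {v} uv yu≃yv with ℕ.<-cmp (pos w′ u) (pos w′ v)
      ... | tri< lt _ _ = <ᴿ-irrefl {y u} {y v} yu≃yv (forward lt)
      ... | tri≈ _ eq _ = Edge-irrefl Q uv (pos-injective (full′ u) (full′ v) eq)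
      ... | tri> _ _ gt = <ᴿ-irrefl {y v} {y u} (≃ᴿ-sym {y u} {y v} yu≃yv) (forward gt)
      backward : ∀ {u v} → Edge Q u v → y u <ᴿ y v → pos w′ u < pos w′ v
      backward {u} {v} uv yu<yv with ℕ.<-cmp (pos w′ u) (pos w′ v)
      ... | tri< lt _ _ = lt
      ... | tri≈ _ eq _ = contradiction (pos-injective (full′ u) (full′ v) eq) (Edge-irrefl Q uv)
      ... | tri> _ _ gt = contradiction yu<yv (<ᴿ-asym {y v} {y u} (forward gt))

  -- The chamber inclusion is tested at one point, whose coordinates climb the `rung` sequence in
  -- the order of `w′`. The chamber returns some representative `y` of that point, and uniqueness in
  -- [0,1) carries the orientation back to positions.
  toric-orient : ∀ (Q : Quiver V) {w w′} → IsToricExtension Q w → w ≈rot w′ →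
    ∃ λ Q′ → (Q ≈flip Q′) × (∀ u v → T (arc Q′ u v) ⇔ (Edge Q u v × pos w′ u < pos w′ v))
  toric-orient Q {w} {w′} (perm , chamber) r =
    let _ , y , y≡x , Q′ , flips , arcs =
          chamber x (x , (λ v → proj₁ (unit v) , proj₂ (unit v) , ∼ℤ-refl {x v}) , w′ , r , ordered)
    in Q′ , flips , λ u v → ⇔-trans (arcs u v) (mk⇔
      (λ (e , lt) → e , rung-cancel-< {pos w′ u} {pos w′ v}
        (<ᴿ-resp-≃ᴿ {y u} {x u} {y v} {x v} (y≃x {y} y≡x u) (y≃x {y} y≡x v) lt))
      (λ (e , lt) → e , <ᴿ-resp-≃ᴿ {x u} {y u} {x v} {y v}
        (≃ᴿ-sym {y u} {x u} (y≃x {y} y≡x u)) (≃ᴿ-sym {y v} {x v} (y≃x {y} y≡x v))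
        (fromℚ-mono-< (rung-mono-< {pos w′ u} {pos w′ v} lt))))
    where
    x : V → ℝ
    x v = fromℚ (rung (pos w′ v))
    unit : ∀ v → InUnit (x v)
    unit v = rung-InUnit (pos w′ v)
    ordered : AllPairs (λ u v → x u <ᴿ x v) w′
    ordered = AllPairs.map (λ {u} {v} lt → fromℚ-mono-< (rung-mono-< {pos w′ u} {pos w′ v} lt))
      (pos-increasing (proj₁ (≈rot-permutation r perm)))
    y≃x : ∀ {y} → y ≡ x mod1 → ∀ v → y v ≃ᴿ x v
    y≃x {y} y≡x v = InUnit-unique {y v} {x v} (proj₁ (y≡x v) , proj₁ (proj₂ (y≡x v))) (unit v)
      (∼ℤ-sym {x v} {y v} (proj₂ (proj₂ (y≡x v))))

-- Flip invariants

module Heights (_≟_ : DecidableEquality V) where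
  open Quiver using (arc; IsSource; IsSink)
  open Orientation _≟_ using (Edge-irrefl)

  -- t counts signed flips at each vertex (+1 when a source becomes a sink).
  Height : Quiver V → Quiver V → (V → ℤ) → Set
  Height Q Q′ t = ∀ {u v} → T (arc Q u v) →
    (t u ≡ t v × T (arc Q′ u v)) ⊎ (t u ≡ ℤ.suc (t v) × T (arc Q′ v u))

  update : (ℤ → ℤ) → V → (V → ℤ) → V → ℤ
  update f z t v with v ≟ z
  ... | yes _ = f (t v)
  ... | no  _ = t v

  -- At a source of `Q′`, each arc of `Q` leaving `z` is still unreversed and each arc entering it
  -- is reversed. Raising `t z` by 1 thus moves the differences from 0 to 1 and from 1 to 0
  -- respectively; a sink is dual.
  height-flip : ∀ {Q Q′ Q″ t} → Height Q Q′ t → Flip Q′ Q″ → ∃ (Height Q Q″)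
  height-flip {Q} {Q′} {Q″} {t} height F = go (Flip.source-or-sink F)
    where
    z = Flip.vertex F
    rev : ∀ {u v} → u ≡ z ⊎ v ≡ z → T (arc Q′ v u) → T (arc Q″ u v)
    rev {u} {v} uv = ≡.subst T (≡.sym (Flip.reversed F u v uv))
    keep : ∀ {u v} → u ≢ z → v ≢ z → T (arc Q′ u v) → T (arc Q″ u v)
    keep {u} {v} u≢z v≢z = ≡.subst T (≡.sym (Flip.unchanged F u v u≢z v≢z))

    go : IsSource Q′ z ⊎ IsSink Q′ z → ∃ (Height Q Q″)
    go (inj₁ source) = update ℤ.suc z t , height′
      where
      height′ : Height Q Q″ (update ℤ.suc z t)
      height′ {u} {v} uv with u ≟ z | v ≟ z | height uv
      ... | yes ≡.refl | yes ≡.refl | _             = contradiction ≡.refl (Edge-irrefl Q (inj₁ uv))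
      ... | yes ≡.refl | no  _      | inj₁ (e , uv′) = inj₂ (≡.cong ℤ.suc e , rev (inj₂ ≡.refl) uv′)
      ... | yes ≡.refl | no  _      | inj₂ (_ , vu′) = contradiction vu′ (source v)
      ... | no  _      | yes ≡.refl | inj₁ (_ , uv′) = contradiction uv′ (source u)
      ... | no  _      | yes ≡.refl | inj₂ (e , vu′) = inj₁ (e , rev (inj₂ ≡.refl) vu′)
      ... | no  u≢z    | no  v≢z    | inj₁ (e , uv′) = inj₁ (e , keep u≢z v≢z uv′)
      ... | no  u≢z    | no  v≢z    | inj₂ (e , vu′) = inj₂ (e , keep v≢z u≢z vu′)
    go (inj₂ sink) = update ℤ.pred z t , height′
      where
      height′ : Height Q Q″ (update ℤ.pred z t)
      height′ {u} {v} uv with u ≟ z | v ≟ z | height uv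
      ... | yes ≡.refl | yes ≡.refl | _             = contradiction ≡.refl (Edge-irrefl Q (inj₁ uv))
      ... | yes ≡.refl | no  _      | inj₁ (_ , uv′) = contradiction uv′ (sink v)
      ... | yes ≡.refl | no  _      | inj₂ (e , vu′) =
        inj₁ (≡.trans (≡.cong ℤ.pred e) (ℤ.pred-suc (t v)) , rev (inj₁ ≡.refl) vu′)
      ... | no  _      | yes ≡.refl | inj₁ (e , uv′) =
        inj₂ (≡.trans e (≡.sym (ℤ.suc-pred (t v))) , rev (inj₁ ≡.refl) uv′)
      ... | no  _      | yes ≡.refl | inj₂ (_ , vu′) = contradiction vu′ (sink u)
      ... | no  u≢z    | no  v≢z    | inj₁ (e , uv′) = inj₁ (e , keep u≢z v≢z uv′)
      ... | no  u≢z    | no  v≢z    | inj₂ (e , vu′) = inj₂ (e , keep v≢z u≢z vu′)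

  height-flips : ∀ {Q Q′ Q″ t} → Height Q Q′ t → Q′ ≈flip Q″ → ∃ (Height Q Q″)
  height-flips height Star.ε       = _ , height
  height-flips {Q} {Q′} {Q″} {t} height (_◅_ {j = Q₁} F r) =
    height-flips {Q} {Q₁} {Q″} (proj₂ (height-flip {Q} {Q′} {Q₁} {t} height F)) r

  ≈flip-height : ∀ {Q Q′} → Q ≈flip Q′ → ∃ (Height Q Q′)
  ≈flip-height {Q} {Q′} r = height-flips {Q} {Q} {Q′} {λ _ → 0ℤ} (λ uv → inj₁ (≡.refl , uv)) r

  module _ {Q Q′ : Quiver V} {e : V} (source : IsSource Q′ e) where

    private
      Arc Arc′ : V × V → Set
      Arc  = uncurry λ u v → T (arc Q u v)
      Arc′ = uncurry λ u v → T (arc Q′ u v)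

    module _ {t : V → ℤ} (height : Height Q Q′ t) where

      -- Heights never increase along arcs of `Q`, and the last arc must be reversed because `e` is
      -- a source of `Q′`, so its tail has height exactly one above `e`.
      path-height : ∀ v l → All Arc (steps (v ∷ l ++ [ e ])) → ℤ.suc (t e) ℤ.≤ t v
      path-height v [] (ve ∷ []) with height ve
      ... | inj₁ (_ , ve′) = contradiction ve′ (source v)
      ... | inj₂ (eq , _)  = ℤ.≤-reflexive (≡.sym eq)
      path-height v (x ∷ l) (vx ∷ arcs) with path-height x l arcs | height vx
      ... | ih | inj₁ (eq , _) = ℤ.≤-trans ih (ℤ.≤-reflexive (≡.sym eq))
      ... | ih | inj₂ (eq , _) =
        ℤ.≤-trans ih (ℤ.≤-trans (ℤ.i≤suc[i] (t x)) (ℤ.≤-reflexive (≡.sym eq)))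

      -- A reversed arc from `v` to `x` would put `v` at least two above `e`, since `x` is already
      -- at least one above. The arc into `e` is left out because it is always reversed.
      path-forward : ∀ v l → All Arc (steps (v ∷ l ++ [ e ])) → t v ℤ.≤ ℤ.suc (t e) →
        All Arc′ (steps (v ∷ l))
      path-forward v []      _           _  = []
      path-forward v (x ∷ l) (vx ∷ arcs) tv with height vx
      ... | inj₁ (eq , vx′) = vx′ ∷ path-forward x l arcs (≡.subst (ℤ._≤ ℤ.suc (t e)) eq tv)
      ... | inj₂ (eq , _)   = contradiction
        (ℤ.≤-trans (ℤ.suc-mono (path-height x l arcs)) (≡.subst (ℤ._≤ ℤ.suc (t e)) eq tv))
        (ℤ.<⇒≱ (ℤ.suc[i]≤j⇒i<j ℤ.≤-refl))

    flip-path-forward : Q ≈flip Q′ → ∀ z l → T (arc Q z e) →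
      All Arc (steps (z ∷ l ++ [ e ])) → All Arc′ (steps (z ∷ l))
    flip-path-forward r z l ze arcs with t , height ← ≈flip-height r | height ze
    ... | inj₁ (_ , ze′) = contradiction ze′ (source z)
    ... | inj₂ (eq , _)  = path-forward {t} height z l arcs (ℤ.≤-reflexive eq)

-- The quiver of the theorem

module _ (k j : ℕ) where

  private
    bs = 𝐛 k j
    cs = 𝐜 k j

  𝐛𝐜-disjoint : Disjoint bs cs
  𝐛𝐜-disjoint (v∈𝐛 , v∈𝐜) with ∈-tabulate⁻ {f = Vertex.b} v∈𝐛 | ∈-tabulate⁻ {f = Vertex.c} v∈𝐜
  ... | _ , ≡.refl | _ , ()

  standard-unique : Unique (1̂ ∷ 0̂ ∷ bs ++ cs)
  standard-unique =
    ((λ ()) ∷ All.++⁺ (All.tabulate⁺ {f = Vertex.b} λ _ ()) (All.tabulate⁺ {f = Vertex.c} λ _ ())) ∷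
    All.++⁺ (All.tabulate⁺ {f = Vertex.b} λ _ ()) (All.tabulate⁺ {f = Vertex.c} λ _ ()) ∷
    Unique.++⁺ (Unique.tabulate⁺ {f = Vertex.b} λ { ≡.refl → ≡.refl })
      (Unique.tabulate⁺ {f = Vertex.c} λ { ≡.refl → ≡.refl }) 𝐛𝐜-disjoint

  standard-full : ∀ v → v ∈ 1̂ ∷ 0̂ ∷ bs ++ cs
  standard-full 0̂            = there (here ≡.refl)
  standard-full 1̂            = here ≡.refl
  standard-full (Vertex.b r) = there (there (∈-++⁺ˡ (∈-tabulate⁺ r)))
  standard-full (Vertex.c s) = there (there (∈-++⁺ʳ bs (∈-tabulate⁺ s)))

  shuffle-permutation : ∀ {as} → IsShuffle bs cs as → IsPermutation (1̂ ∷ 0̂ ∷ as)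
  shuffle-permutation (p , _) =
    AllPairs-resp-↭ (_∘ ≡.sym) p′ standard-unique , λ v → ↭.∈-resp-↭ p′ (standard-full v)
    where p′ = prep 1̂ (prep 0̂ (↭-sym p))

  shuffle-unique : ∀ {as} → IsShuffle bs cs as → Unique as
  shuffle-unique sh with _ ∷ _ ∷ u ← proj₁ (shuffle-permutation sh) = u

  shuffleReps : Representatives (IsShuffle bs cs) _≡_
  shuffleReps = record
    { reps     = shuffles bs cs
    ; sound    = shuffles-sound bs cs
    ; distinct = shuffles-unique 𝐛𝐜-disjoint
    ; complete = λ as sh → shuffles-complete (shuffle-unique sh) 𝐛𝐜-disjoint sh
    }

  open RationalFunctions (_≟ⱽ_ {k} {j})
  open Sums (_≟ⱽ_ {k} {j})
  open CommutativeRing ℚ⟨V⟩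
  open PartialFractions (_≟ⱽ_ {k} {j}) using (∑-Ψ-shuffles; Ψ-rev)
  open Fold +-commutativeMonoid using (fold-reps)

  private
    s : Carrier
    s = -1^ k * 1/∏-diff (map swap (steps (path-b k j)) ++ steps (path-c k j))

  ∑-Ψ : ∑ (shuffles bs cs) (λ as → Ψ (1̂ ∷ 0̂ ∷ as)) ≈ s
  ∑-Ψ = ∑-Ψ-shuffles {k} 1̂ 0̂ bs cs (List.length-tabulate Vertex.b) standard-unique

  shuffle-sum : SumOver (IsShuffle bs cs) _≡_ (λ as → Ψ (1̂ ∷ 0̂ ∷ as))
    (-1^ k * Ψ (1̂ ∷ reverse bs ++ 0̂ ∷ cs))
  shuffle-sum = shuffleReps , λ R →
    trans {∑ (reps R) f} {∑ (reps shuffleReps) f} {t}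
      (fold-reps ≡.sym ≡.trans {f} (λ { {x} _ ≡.refl → refl {f x} }) R shuffleReps)
      (trans {∑ (reps shuffleReps) f} {s} {t} ∑-Ψ
        (sym {t} {s} (*-congˡ { -1^ k} {Ψ (1̂ ∷ reverse bs ++ 0̂ ∷ cs)}
           {1/∏-diff (map swap (steps (path-b k j)) ++ steps (path-c k j))} (Ψ-rev 1̂ 0̂ bs cs))))
    where
    f : List (Vertex k j) → Carrier
    f as = Ψ (1̂ ∷ 0̂ ∷ as)
    t : Carrier
    t = -1^ k * Ψ (1̂ ∷ reverse bs ++ 0̂ ∷ cs)

-- Toric total extensions of the class of `Q`

module _ (k j : ℕ) where

  private
    bs = 𝐛 k j
    cs = 𝐜 k j
    _≟_ = _≟ⱽ_ {k} {j}

  open Positions _≟_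
  open Orientation _≟_
  open Heights _≟_
  open Quiver (Q k j) using (_⟶_)
  open DecMembership (Product.≡-dec _≟_ _≟_) using (_∈?_)

  arc⇒∈ : ∀ {u v} → u ⟶ v → (u , v) ∈ arcs k j
  arc⇒∈ {u} {v} = toWitness {a? = (u , v) ∈? arcs k j}

  ∈⇒arc : ∀ {u v} → (u , v) ∈ arcs k j → u ⟶ v
  ∈⇒arc {u} {v} = fromWitness {a? = (u , v) ∈? arcs k j}

  -- Both paths without 1̂ embed in `0̂ ∷ as`, so every arc that avoids 1̂ points forward along the
  -- word, and `flip-sink` at 1̂ applies.
  shuffle⇒toric : ∀ {as} → IsShuffle bs cs as → IsToricExtension (Q k j) (1̂ ∷ 0̂ ∷ as)
  shuffle⇒toric {as} sh@(_ , b⊆ , c⊆) = orient-toric (Q k j) w perm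
    (flip-sink (Q k j) 1̂ (0̂ ∷ as) (λ v 1v → proj₁ (arc-R 1v) ≡.refl)
      (λ uv → proj₂ (arc-R uv)) ◅ Star.ε)
    where
    w = 1̂ ∷ 0̂ ∷ as
    perm = shuffle-permutation k j sh
    -- `R` packs the two hypotheses of `flip-sink`: no arc leaves 1̂, and an arc not ending in 1̂
    -- points forward. It is proved for all ordered pairs on a path and then restricted to its
    -- steps.
    R : Rel (Vertex k j) _
    R u v = u ≢ 1̂ × (v ≢ 1̂ → pos w u < pos w v)
    ≢1̂ : All (_≢ 1̂) (0̂ ∷ as)
    ≢1̂ = All.map (_∘ ≡.sym) (AllPairs.head (proj₁ perm))
    R-as : AllPairs R (0̂ ∷ as)
    R-as = AllPairs.map (λ (n , lt) → n , λ _ → lt)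
      (AllPairs-zipˡ ≢1̂ (AllPairs.tail (pos-increasing (proj₁ perm))))
    R-path : ∀ {l} → l ⊆ as → All (uncurry R) (steps (0̂ ∷ l ++ [ 1̂ ]))
    R-path {l} l⊆ = AllPairs⇒steps (AllPairs.++⁺ {xs = 0̂ ∷ l}
      (AllPairs-resp-⊆ (≡.refl ∷ l⊆) R-as) ([] ∷ [])
      (All.map (λ n → (n , λ 1≢1 → contradiction ≡.refl 1≢1) ∷ []) (Sublist.All-resp-⊆ (≡.refl ∷ l⊆) ≢1̂)))
    arc-R : ∀ {u v} → u ⟶ v → R u v
    arc-R uv = All.lookup (All.++⁺ (R-path b⊆) (All.++⁺ (R-path c⊆)
      (((λ ()) , λ 1≢1 → contradiction ≡.refl 1≢1) ∷ []))) (arc⇒∈ uv)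

  -- The letter after 1̂ belongs to one of the two embedded words. An embedded word that contains it
  -- must begin with it, and both begin with 0̂.
  0̂-second : ∀ {r} → IsPermutation (1̂ ∷ r) → 0̂ ∷ bs ⊆ 1̂ ∷ r → 0̂ ∷ cs ⊆ 1̂ ∷ r →
    ∃ λ as → r ≡ 0̂ ∷ as × IsShuffle bs cs as
  0̂-second {r} perm 0b⊆ 0c⊆ = go r r↭ (proj₁ perm)
    (⊆-drop (1̂∉ ∘ ∈-++⁺ˡ) 0b⊆)
    (⊆-drop (λ { (there i) → 1̂∉ (∈-++⁺ʳ (0̂ ∷ bs) i) }) 0c⊆)
    where
    1̂∉ : 1̂ ∉ 0̂ ∷ bs ++ cs
    1̂∉ = Unique.Unique[x∷xs]⇒x∉xs (standard-unique k j)
    r↭ : r ↭ 0̂ ∷ bs ++ cs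
    r↭ = ↭.drop-∷ (IsPermutation-↭ perm (standard-unique k j , standard-full k j))
    h≡0̂ : ∀ {h as} → h ∉ as → 0̂ ∷ bs ⊆ h ∷ as → 0̂ ∷ cs ⊆ h ∷ as →
      h ∈ 0̂ ∷ bs ⊎ h ∈ cs → h ≡ 0̂
    h≡0̂ h∉as s t (inj₁ i) = let _ , e , _ = ⊆-∷⁻ h∉as i s in ≡.sym (List.∷-injectiveˡ e)
    h≡0̂ h∉as s t (inj₂ i) = let _ , e , _ = ⊆-∷⁻ h∉as (there i) t in ≡.sym (List.∷-injectiveˡ e)
    go : ∀ r → r ↭ 0̂ ∷ bs ++ cs → Unique (1̂ ∷ r) → 0̂ ∷ bs ⊆ r → 0̂ ∷ cs ⊆ r →
      ∃ λ as → r ≡ 0̂ ∷ as × IsShuffle bs cs as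
    go (h ∷ as) p (_ ∷ u) s t
      with ≡.refl ← h≡0̂ (Unique.Unique[x∷xs]⇒x∉xs u) s t
                       (∈-++⁻ (0̂ ∷ bs) (↭.∈-resp-↭ p (here ≡.refl)))
      with _ , ≡.refl , b⊆ ← ⊆-∷⁻ (Unique.Unique[x∷xs]⇒x∉xs u) (here ≡.refl) s
         | _ , ≡.refl , c⊆ ← ⊆-∷⁻ (Unique.Unique[x∷xs]⇒x∉xs u) (here ≡.refl) t =
      as , ≡.refl , ↭.drop-∷ p , b⊆ , c⊆

  -- Standing first makes 1̂ a source of `Q′`, so the height argument keeps both paths, up to their
  -- last arcs, pointing forward. Transitivity extends this from steps to all pairs, which gives the
  -- embeddings.
  source-order⇒shuffle : ∀ {r Q′} → IsPermutation (1̂ ∷ r) → Q k j ≈flip Q′ →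
    (∀ u v → T (Quiver.arc Q′ u v) → pos (1̂ ∷ r) u < pos (1̂ ∷ r) v) →
    ∃ λ as → r ≡ 0̂ ∷ as × IsShuffle bs cs as
  source-order⇒shuffle {r} {Q′} perm flips forward =
    0̂-second perm (path⊆ bs b-path) (path⊆ cs c-path)
    where
    source : Quiver.IsSource Q′ 1̂
    source u u1 = ℕ.n≮0 (≡.subst (pos (1̂ ∷ r) u <_) (pos-here 1̂ r) (forward u 1̂ u1))
    top : 0̂ ⟶ 1̂
    top = ∈⇒arc (∈-++⁺ʳ (steps (path-b k j)) (∈-++⁺ʳ (steps (path-c k j)) (here ≡.refl)))
    b-path : All (uncurry _⟶_) (steps (path-b k j))
    b-path = All.tabulate (∈⇒arc ∘ ∈-++⁺ˡ)
    c-path : All (uncurry _⟶_) (steps (path-c k j))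
    c-path = All.tabulate (∈⇒arc ∘ ∈-++⁺ʳ (steps (path-b k j)) ∘ ∈-++⁺ˡ)
    path⊆ : ∀ l → All (uncurry _⟶_) (steps (0̂ ∷ l ++ [ 1̂ ])) → 0̂ ∷ l ⊆ 1̂ ∷ r
    path⊆ l path = pos-⊆ (All.tabulate λ _ → proj₂ perm _)
      (Linked.Linked⇒AllPairs ℕ.<-trans (steps⇒Linked (0̂ ∷ l)
        (All.map (λ {p} → forward (proj₁ p) (proj₂ p))
          (flip-path-forward {Q k j} {Q′} source flips 0̂ l top path))))

  toric⇒shuffle : ∀ {w} → IsToricExtension (Q k j) w →
    ∃ λ as → IsShuffle bs cs as × w ≈rot (1̂ ∷ 0̂ ∷ as)
  toric⇒shuffle {w} tor =
    let r , w≈ = rotate-to (proj₂ (proj₁ tor) 1̂)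
        Q′ , flips , arcs′ = toric-orient (Q k j) tor w≈
        as , r≡ , sh = source-order⇒shuffle (≈rot-permutation w≈ (proj₁ tor)) flips
          (λ u v → proj₂ ∘ to (arcs′ u v))
    in as , sh , ≡.subst (λ l → w ≈rot (1̂ ∷ l)) r≡ w≈

  shuffle-words-complete : ∀ {w} → (∃ λ as → IsShuffle bs cs as × w ≈rot (1̂ ∷ 0̂ ∷ as)) →
    Any (w ≈rot_) (map (λ as → 1̂ ∷ 0̂ ∷ as) (shuffles bs cs))
  shuffle-words-complete {w} (as , sh , r) = Any.map⁺ (Any.map (λ e → ≡.subst (λ as′ → w ≈rot (1̂ ∷ 0̂ ∷ as′)) e r)
    (shuffles-complete (shuffle-unique k j sh) (𝐛𝐜-disjoint k j) sh))

  -- The common head 1̂ fixes the rotation, so equivalent words would come from equal shuffles.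
  shuffle-words-distinct : AllPairs (λ w w′ → ¬ (w ≈rot w′)) (map (λ as → 1̂ ∷ 0̂ ∷ as) (shuffles bs cs))
  shuffle-words-distinct = AllPairs.map⁺ (AllPairs.map
    (λ (sh , as≢) r → as≢ (List.∷-injectiveʳ (≈rot-head (proj₁ (shuffle-permutation k j sh)) r)))
    (AllPairs-zipˡ (shuffles-sound bs cs) (shuffles-unique (𝐛𝐜-disjoint k j))))

  toricReps : Representatives (IsToricExtension (Q k j)) _≈rot_
  toricReps = record
    { reps     = map (λ as → 1̂ ∷ 0̂ ∷ as) (shuffles bs cs)
    ; sound    = All.map⁺ (All.map shuffle⇒toric (shuffles-sound bs cs))
    ; distinct = shuffle-words-distinct
    ; complete = λ w tor → shuffle-words-complete (toric⇒shuffle tor)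
    }

  open RationalFunctions _≟_
  open Sums _≟_
  open CommutativeRing ℚ⟨V⟩
  open PartialFractions _≟_ using (Ψ-≈rot)
  open Fold +-commutativeMonoid using (fold-reps; fold-map)

  toric-sum : Ψtor (Q k j) (-1^ k * 1/∏-diff (map swap (steps (path-b k j)) ++ steps (path-c k j)))
  toric-sum = toricReps , λ R →
    trans {∑ (reps R) Ψ} {∑ (reps toricReps) Ψ} {s}
      (fold-reps ≈rot-sym _◅◅_ {Ψ} (λ _ → Ψ-≈rot) R toricReps)
      (≡.subst (_≈ s) (≡.sym (fold-map (λ as → 1̂ ∷ 0̂ ∷ as) (shuffles bs cs) Ψ)) (∑-Ψ k j))
    where
    s : Carrier
    s = -1^ k * 1/∏-diff (map swap (steps (path-b k j)) ++ steps (path-c k j))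

corollary1p7 : ∀ (k j : ℕ) → 1 ≤ k → 1 ≤ j →
    let open RationalFunctions (_≟ⱽ_ {k} {j})
        open Sums (_≟ⱽ_ {k} {j})
        open CommutativeRing ℚ⟨V⟩ using (_*_)
    in
      Ψtor (Q k j)
        (-1^ k * 1/∏-diff (map swap (steps (path-b k j)) ++ steps (path-c k j)))
      ×
      SumOver (IsShuffle (𝐛 k j) (𝐜 k j)) _≡_ (λ 𝐚 → Ψ (1̂ ∷ 0̂ ∷ 𝐚))
        (-1^ k * Ψ (1̂ ∷ reverse (𝐛 k j) ++ 0̂ ∷ 𝐜 k j))
corollary1p7 k j _ _ = toric-sum k j , shuffle-sum k j
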